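{- Every $(2K_2,K_4,H_4)$-free graph that contains an induced $W_5$ is recolorable.
   Context: All graphs are finite and simple. For graphs $F_1,\dots,F_t$, a graph $G$ is $(F_1,\dots,F_t)$-free if no induced subgraph of $G$ is isomorphic to any $F_j$. $2K_2$ is the disjoint union of two copies of $K_2$, and $K_4$ is the complete graph on four vertices. $W_5$ is the graph on six vertices obtained from a $5$-cycle by adding one new vertex adjacent to all five cycle vertices. $H_4$ is the graph on six vertices obtained from a $5$-cycle by adding one new vertex adjacent to exactly four of the cycle vertices. An $\ell$-coloring of $G$ is a map $V(G)\to\{1,\dots,\ell\}$ giving adjacent vertices distinct colors (not all colors need be used); $\chi(G)$ is the least $\ell$ for which an $\ell$-coloring exists. The reconfiguration graph $\mathcal{R}_\ell(G)$ has the $\ell$-colorings of $G$ as vertices, with two colorings adjacent whenever they differ on exactly one vertex of $G$. The graph $G$ is recolorable if $\mathcal{R}_\ell(G)$ is connected for every $\ell>\chi(G)$. -}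

module Defs where

open import Data.Empty using (⊥)
open import Data.Fin using (Fin; zero; toℕ; _≟_)
open import Data.Fin.Properties using (any?; all?)
open import Data.Fin.Subset using (Subset; _∈_; ⊤; ∁; ⁅_⁆)
open import Data.Fin.Subset.Properties using (_∈?_)
open import Data.Maybe using (Maybe; just; nothing)
open import Data.Nat using (ℕ; suc; _≤_; _<_; _%_)
import Data.Nat.Properties as ℕ
open import Data.Product using (∃; ∃!; ∃-syntax; _,_; proj₁)
open import Data.Sum using (_⊎_; inj₁; inj₂; swap)
open import Data.Sum.Relation.Binary.Pointwise
  using (Pointwise; inj₁; inj₂; ⊎-symmetric; ⊎-decidable)
open import Data.Vec using (Vec; lookup)
open import Function using (_∘_; _↔_; _⇔_; Inverse)
open import Level using (0ℓ)
open import Relation.Binary using (Rel; Symmetric; Decidable)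
open import Relation.Binary.Construct.Closure.ReflexiveTransitive using (Star)
open import Relation.Binary.PropositionalEquality using (_≡_; _≢_; refl; sym)
open import Relation.Nullary using (¬_; Dec; no)
open import Relation.Nullary.Decidable
  using (¬?; map′; _×-dec_; _⊎-dec_; _→-dec_; from-yes)

private
  variable
    V W : Set
    n : ℕ

-- A classical adjacency relation is two-valued, hence the field Adj?.
record Graph (V : Set) : Set₁ where
  field
    Adj     : Rel V 0ℓ
    Adj?    : Decidable Adj
    Adj-sym : Symmetric Adj
    irrefl  : ∀ v → ¬ Adj v v

open Graph public

Connected : Graph V → Set
Connected G = ∀ u v → Star (Adj G) u v

record _≅_ (G : Graph V) (H : Graph W) : Set where
  field
    bijection : V ↔ W
    adjacency : ∀ u v → Adj G u v ⇔ Adj H (Inverse.to bijection u) (Inverse.to bijection v)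

induced : Graph (Fin n) → (S : Subset n) → Graph (∃ (_∈ S))
induced G S = record
  { Adj     = λ u v → Adj G (proj₁ u) (proj₁ v)
  ; Adj?    = λ u v → Adj? G (proj₁ u) (proj₁ v)
  ; Adj-sym = Adj-sym G
  ; irrefl  = λ v → irrefl G (proj₁ v)
  }

_ContainsInduced_ : Graph (Fin n) → Graph W → Set
G ContainsInduced F = ∃[ S ] (induced G S ≅ F)

_FreeOf_ : Graph (Fin n) → Graph W → Set
G FreeOf F = ¬ (G ContainsInduced F)

K : ∀ n → Graph (Fin n)
K n = record
  { Adj     = _≢_
  ; Adj?    = λ u v → ¬? (u ≟ v)
  ; Adj-sym = λ u≢v → u≢v ∘ sym
  ; irrefl  = λ v v≢v → v≢v refl
  }

disjointUnion : Graph V → Graph W → Graph (V ⊎ W)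
disjointUnion G H = record
  { Adj     = Pointwise (Adj G) (Adj H)
  ; Adj?    = ⊎-decidable (Adj? G) (Adj? H)
  ; Adj-sym = ⊎-symmetric (Adj-sym G) (Adj-sym H)
  ; irrefl  = λ { (inj₁ v) (inj₁ a) → irrefl G v a
                ; (inj₂ v) (inj₂ a) → irrefl H v a }
  }

2K₂ : Graph (Fin 2 ⊎ Fin 2)
2K₂ = disjointUnion (K 2) (K 2)

C₅ : Graph (Fin 5)
C₅ = record
  { Adj     = λ u v → u ⟶ v ⊎ v ⟶ u
  ; Adj?    = λ u v → (u ⟶? v) ⊎-dec (v ⟶? u)
  ; Adj-sym = swap
  ; irrefl  = from-yes (all? λ v → ¬? ((v ⟶? v) ⊎-dec (v ⟶? v)))
  }
  where
  _⟶_ : Rel (Fin 5) 0ℓ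
  u ⟶ v = toℕ v ≡ suc (toℕ u) % 5

  _⟶?_ : Decidable _⟶_
  u ⟶? v = toℕ v ℕ.≟ suc (toℕ u) % 5

-- G plus one new vertex, `nothing`, whose neighbourhood is N.
addVertex : Graph (Fin n) → Subset n → Graph (Maybe (Fin n))
addVertex {n} G N = record
  { Adj     = Adj′
  ; Adj?    = Adj′?
  ; Adj-sym = λ {u} {v} → Adj′-sym u v
  ; irrefl  = λ { (just v) → irrefl G v ; nothing () }
  }
  where
  Adj′ : Rel (Maybe (Fin n)) 0ℓ
  Adj′ (just u) (just v) = Adj G u v
  Adj′ (just u) nothing  = u ∈ N
  Adj′ nothing  (just v) = v ∈ N
  Adj′ nothing  nothing  = ⊥

  Adj′? : Decidable Adj′
  Adj′? (just u) (just v) = Adj? G u v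
  Adj′? (just u) nothing  = u ∈? N
  Adj′? nothing  (just v) = v ∈? N
  Adj′? nothing  nothing  = no λ ()

  Adj′-sym : ∀ u v → Adj′ u v → Adj′ v u
  Adj′-sym (just u) (just v) = Adj-sym G
  Adj′-sym (just u) nothing  a = a
  Adj′-sym nothing  (just v) a = a

W₅ : Graph (Maybe (Fin 5))
W₅ = addVertex C₅ ⊤

-- By the symmetry of C₅ it does not matter which cycle vertex is missed.
H₄ : Graph (Maybe (Fin 5))
H₄ = addVertex C₅ (∁ ⁅ zero ⁆)

-- The colours are stored in a vector rather than given by a function
-- Fin n → Fin ℓ so that, without function extensionality, colourings that
-- agree at every vertex are still equal.
record Colouring (G : Graph (Fin n)) (ℓ : ℕ) : Set where
  field
    colours : Vec (Fin ℓ) n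

  colour : Fin n → Fin ℓ
  colour = lookup colours

  field
    proper : ∀ u v → Adj G u v → colour u ≢ colour v

open Colouring public

record IsChromaticNumber (G : Graph (Fin n)) (k : ℕ) : Set where
  field
    colouring : Colouring G k
    least     : ∀ ℓ → Colouring G ℓ → k ≤ ℓ

reconfigurationGraph : (G : Graph (Fin n)) (ℓ : ℕ) → Graph (Colouring G ℓ)
reconfigurationGraph {n} G ℓ = record
  { Adj     = λ c d → ∃! _≡_ (Differ c d)
  ; Adj?    = λ c d → any? λ v → differ? c d v ×-dec
                map′ (λ f {w} → f w) (λ f w → f {w})
                     (all? λ w → differ? c d w →-dec (v ≟ w))
  ; Adj-sym = λ (v , c≢d , unique) → v , c≢d ∘ sym , λ d≢c → unique (d≢c ∘ sym)
  ; irrefl  = λ c (v , c≢c , _) → c≢c refl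
  }
  where
  Differ : Colouring G ℓ → Colouring G ℓ → Fin n → Set
  Differ c d v = colour c v ≢ colour d v

  differ? : ∀ c d v → Dec (Differ c d v)
  differ? c d v = ¬? (colour c v ≟ colour d v)

Recolourable : Graph (Fin n) → Set
Recolourable G = ∀ k → IsChromaticNumber G k →
                 ∀ ℓ → k < ℓ → Connected (reconfigurationGraph G ℓ)

{-# OPTIONS --safe #-}

-- Let v₀ … v₄ be the 5-cycle of an induced W₅ and w its hub. By 2K₂- and
-- H₄-freeness a vertex meets the cycle like some vᵢ (class Aᵢ), in
-- {vᵢ, vᵢ₊₂, vᵢ₊₃} (class Yᵢ), everywhere (W) or nowhere (Z). Replacing vᵢ by
-- another vertex of Aᵢ gives another such cycle, from which it follows that
-- these twelve classes map G homomorphically to the complement of the icosahedron.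
--
-- Fix ℓ ≥ 5 and a colouring. First each Aᵢ is made monochromatic, then W gets
-- the colour α of w; as Yᵢ and Yᵢ₊₁ are complete to each other, α occurs in Y
-- only inside some Yᵢ ∪ Yᵢ₊₂ (say i = 0), all of which is painted α. Then Z can
-- be painted as A₁, after which fresh colours for the mixed classes Y₁, Y₃, Y₄
-- reduce the rest to a coloured prism, which is brought down to four colours.
-- This gives a colouring whose four classes are W ∪ Y₀ ∪ Y₂ etc., up to a rotation;
-- a fifth colour lets the rotation advance by two, so a fixed partition is reached
-- from every colouring, and with a spare colour its classes can be renamed at will.
module Submission where

open import Defs
import Data.Bool.Properties as Bool
open import Data.Bool using (Bool; true; false; not; if_then_else_)
open import Data.Empty using (⊥; ⊥-elim)
open import Data.Fin using (Fin; zero; suc; _≟_; toℕ)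
open import Data.Fin.Patterns
open import Data.Fin.Permutation using (transpose; _⟨$⟩ʳ_; _⟨$⟩ˡ_; inverseˡ)
open import Data.Fin.Properties using (all?; any?; +↔⊎; injective⇒≤)
import Data.Fin.Subset as Subset
open import Data.Fin.Subset using (Subset)
open import Data.Fin.Subset.Properties using (anySubset?)
open import Data.List using (List; []; _∷_; allFin; filterᵇ)
import Data.List.Membership.DecPropositional as DecMembership
open import Data.List.Membership.Propositional using (_∈_; _∉_)
open import Data.List.Membership.Propositional.Properties using (∈-allFin)
open import Data.List.Relation.Unary.All as All using (All; []; _∷_)
open import Data.List.Relation.Unary.Any using (here; there)
open import Data.Maybe using (Maybe; just; nothing)
open import Data.Nat using (ℕ; _≤_; _<_; _+_; _∸_)
open import Data.Nat.DivMod using (_mod_)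
open import Data.Nat.Properties using (<⇒≱; ≤-<-trans)
open import Data.Product using (∃; ∃!; ∃-syntax; _×_; _,_; proj₁; proj₂; map₂)
open import Data.Sum as Sum using (_⊎_; inj₁; inj₂)
open import Data.Unit using (⊤; tt)
open import Data.Vec using (lookup; tabulate; []; _∷_)
open import Data.Vec.Properties
  using (lookup∘tabulate; tabulate∘lookup; tabulate-cong; ≡-dec; []=⇒lookup; lookup⇒[]=)
open import Data.Vec.Properties.WithK using ([]=-irrelevant)
open import Function using (_∘_; id; _↔_; _⇔_; Injective; Equivalence; Inverse; mk⇔; mk↔ₛ′)
open import Function.Construct.Identity using (↔-id)
open import Relation.Binary using (DecidableEquality)
open import Relation.Binary.Construct.Closure.ReflexiveTransitive using (Star; ε; _◅_; _◅◅_)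
open import Relation.Binary.PropositionalEquality
open import Relation.Nullary
open import Relation.Nullary.Decidable

-- Roles relative to a 5-cycle

data Role : Set where
  A Y : Fin 5 → Role
  W Z : Role

cyc : Fin 5 → Fin 5 → Bool
cyc i j = does (Adj? C₅ i j)

-- The roles are the vertices of an icosahedron, and `adj` holds between distinct non-neighbours
-- there: `W` and `Z` are the poles, ringed by the Y and the A respectively. The columns `A j` also
-- record which cycle vertices a role sees.
adj : Role → Role → Bool
adj (A i) (A j) = cyc i j
adj (A i) (Y j) = not (cyc i j)
adj (A _) W = true
adj (Y i) (A j) = not (cyc i j)
adj (Y i) (Y j) = cyc i j
adj (Y _) Z = true
adj W (A _) = true
adj W Z = true
adj Z (Y _) = true
adj Z W = true
adj _ _ = false

infixr 6 _⊕_
_⊕_ : Fin 5 → Fin 5 → Fin 5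
i ⊕ j = (toℕ i + toℕ j) mod 5

⊖_ : Fin 5 → Fin 5
⊖ i = (5 ∸ toℕ i) mod 5

allRoles? : {P : Role → Set} → (∀ r → Dec (P r)) → Dec (∀ r → P r)
allRoles? P? =
  map′ (λ { (a , y , w , z) → λ { (A i) → a i ; (Y i) → y i ; W → w ; Z → z } })
       (λ f → (λ i → f (A i)) , (λ i → f (Y i)) , f W , f Z)
       (all? (λ i → P? (A i)) ×-dec all? (λ i → P? (Y i)) ×-dec P? W ×-dec P? Z)

anyRole? : {P : Role → Set} → (∀ r → Dec (P r)) → Dec (∃ P)
anyRole? P? =
  map′ (λ { (inj₁ (i , p)) → A i , p
          ; (inj₂ (inj₁ (i , p))) → Y i , p
          ; (inj₂ (inj₂ (inj₁ p))) → W , p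
          ; (inj₂ (inj₂ (inj₂ p))) → Z , p })
       (λ { (A i , p) → inj₁ (i , p)
          ; (Y i , p) → inj₂ (inj₁ (i , p))
          ; (W , p) → inj₂ (inj₂ (inj₁ p))
          ; (Z , p) → inj₂ (inj₂ (inj₂ p)) })
       (any? (λ i → P? (A i)) ⊎-dec any? (λ i → P? (Y i)) ⊎-dec P? W ⊎-dec P? Z)

_≟ᴿ_ : DecidableEquality Role
A i ≟ᴿ A j = map′ (cong A) (λ { refl → refl }) (i ≟ j)
A _ ≟ᴿ Y _ = no λ ()
A _ ≟ᴿ W = no λ ()
A _ ≟ᴿ Z = no λ ()
Y i ≟ᴿ Y j = map′ (cong Y) (λ { refl → refl }) (i ≟ j)
Y _ ≟ᴿ A _ = no λ ()
Y _ ≟ᴿ W = no λ ()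
Y _ ≟ᴿ Z = no λ ()
W ≟ᴿ A _ = no λ ()
W ≟ᴿ Y _ = no λ ()
W ≟ᴿ W = yes refl
W ≟ᴿ Z = no λ ()
Z ≟ᴿ A _ = no λ ()
Z ≟ᴿ Y _ = no λ ()
Z ≟ᴿ W = no λ ()
Z ≟ᴿ Z = yes refl

adj-sym : ∀ p q → adj p q ≡ adj q p
adj-sym = from-yes (allRoles? λ p → allRoles? λ q → adj p q Bool.≟ adj q p)

-- Rotations of the roles

rotate : Fin 5 → Role → Role
rotate k (A i) = A (k ⊕ i)
rotate k (Y i) = Y (k ⊕ i)
rotate _ W = W
rotate _ Z = Z

⊕-⊖ : ∀ k i → k ⊕ ⊖ k ⊕ i ≡ i
⊕-⊖ = from-yes (all? λ k → all? λ i → k ⊕ ⊖ k ⊕ i ≟ i)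

rotate-⊖ : ∀ k r → rotate (⊖ k) (rotate k r) ≡ r
rotate-⊖ = from-yes (all? λ k → allRoles? λ r → rotate (⊖ k) (rotate k r) ≟ᴿ r)

⊖-⊕ : ∀ k i → ⊖ k ⊕ k ⊕ i ≡ i
⊖-⊕ = from-yes (all? λ k → all? λ i → ⊖ k ⊕ k ⊕ i ≟ i)

rotate-0 : ∀ r → rotate 0F r ≡ r
rotate-0 = from-yes (allRoles? λ r → rotate 0F r ≟ᴿ r)

rotate-221 : ∀ r → rotate 2F (rotate 2F (rotate 1F r)) ≡ r
rotate-221 = from-yes (allRoles? λ r → rotate 2F (rotate 2F (rotate 1F r)) ≟ᴿ r)

rotate-22222 : ∀ r → rotate 2F (rotate 2F (rotate 2F (rotate 2F (rotate 2F r)))) ≡ r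
rotate-22222 = from-yes (allRoles? λ r → rotate 2F (rotate 2F (rotate 2F (rotate 2F (rotate 2F r)))) ≟ᴿ r)

rotate-2224 : ∀ r → rotate 2F (rotate 2F (rotate 2F (rotate 4F r))) ≡ r
rotate-2224 = from-yes (allRoles? λ r → rotate 2F (rotate 2F (rotate 2F (rotate 4F r))) ≟ᴿ r)

adj-rotate : ∀ k p q → adj (rotate k p) (rotate k q) ≡ adj p q
adj-rotate = from-yes (all? λ k → allRoles? λ p → allRoles? λ q →
  adj (rotate k p) (rotate k q) Bool.≟ adj p q)

-- A vertex whose adjacency changes at a single cycle vertex keeps its role,
-- except that a role A may become a role Y and conversely.
Compatible : Role → Role → Bool
Compatible (A _) (Y _) = false
Compatible (Y _) (A _) = false
Compatible _ _ = true

role-determined : ∀ i p q → (∀ j → i ≢ j → adj p (A j) ≡ adj q (A j)) →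
  Compatible p q ≡ true → p ≡ q
role-determined = from-yes (all? λ i → allRoles? λ p → allRoles? λ q →
  all? (λ j → ¬? (i ≟ j) →-dec (adj p (A j) Bool.≟ adj q (A j))) →-dec
  (Compatible p q Bool.≟ true) →-dec (p ≟ᴿ q))

allSubsets? : ∀ {m} {P : Subset m → Set} → (∀ s → Dec (P s)) → Dec (∀ s → P s)
allSubsets? P? = map′
  (λ ¬∃¬ s → decidable-stable (P? s) λ ¬p → ¬∃¬ (s , ¬p))
  (λ f (s , ¬p) → ¬p (f s))
  (¬? (anySubset? λ s → ¬? (P? s)))

-- The first hypothesis is what 2K₂-freeness yields for the cycle edge opposite to `i`, the second
-- what H₄-freeness yields. A check of all 32 subsets of the cycle leaves only the traces of roles.
realised : ∀ (b : Fin 5 → Bool) →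
  (∀ i → b i ≡ true → b (2F ⊕ i) ≡ true ⊎ b (3F ⊕ i) ≡ true) →
  (∀ k → ¬ (∀ i → b i ≡ not (does (k ≟ i)))) →
  ∃[ p ] (∀ i → b i ≡ adj p (A i))
realised b dominating missing = map₂ (λ h i → trans (sym (lookup∘tabulate b i)) (h i))
  (from-yes (allSubsets? λ s →
      all? (λ i → (lookup s i Bool.≟ true) →-dec
        ((lookup s (2F ⊕ i) Bool.≟ true) ⊎-dec (lookup s (3F ⊕ i) Bool.≟ true))) →-dec
      all? (λ k → ¬? (all? λ i → lookup s i Bool.≟ not (does (k ≟ i)))) →-dec
      anyRole? (λ p → all? λ i → lookup s i Bool.≟ adj p (A i)))
    (tabulate b)
    (λ i i∈s → Sum.map (trans (lookup∘tabulate b _)) (trans (lookup∘tabulate b _))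
                       (dominating i (trans (sym (lookup∘tabulate b i)) i∈s)))
    (λ k h → missing k λ i → trans (sym (lookup∘tabulate b i)) (h i)))

-- An independent set of the 5-cycle has at most two vertices, and two of them are at distance two.
-- It will be applied to the indices of the Y classes in which the hub colour occurs.
independent⇒rotation : ∀ (b : Fin 5 → Bool) → (∀ i j → cyc i j ≡ true → b i ≡ true → b j ≡ false) →
  ∃[ k ] (∀ i → b i ≡ true → k ⊕ i ≡ 0F ⊎ k ⊕ i ≡ 2F)
independent⇒rotation b independent = map₂ (λ h i bi → h i (trans (lookup∘tabulate b i) bi))
  (from-yes (allSubsets? λ s →
      all? (λ i → all? λ j → (cyc i j Bool.≟ true) →-dec
        (lookup s i Bool.≟ true) →-dec (lookup s j Bool.≟ false)) →-dec
      any? (λ k → all? λ i → (lookup s i Bool.≟ true) →-dec ((k ⊕ i ≟ 0F) ⊎-dec (k ⊕ i ≟ 2F))))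
    (tabulate b)
    (λ i j ij i∈s → trans (lookup∘tabulate b j) (independent i j ij (trans (sym (lookup∘tabulate b i)) i∈s))))

-- Induced subgraphs

private
  variable
    V : Set
    P Q : Set

does-≡⇒⇔ : (p? : Dec P) (q? : Dec Q) → does p? ≡ does q? → P ⇔ Q
does-≡⇒⇔ (yes p) (yes q) _ = mk⇔ (λ _ → q) (λ _ → p)
does-≡⇒⇔ (no ¬p) (no ¬q) _ = mk⇔ (λ p → contradiction p ¬p) (λ q → contradiction q ¬q)

Maybe↔ : ∀ {m} → Fin (ℕ.suc m) ↔ Maybe (Fin m)
Maybe↔ = mk↔ₛ′ (λ { zero → nothing ; (suc i) → just i })
               (λ { nothing → zero ; (just i) → suc i })
               (λ { nothing → refl ; (just _) → refl })
               (λ { zero → refl ; (suc _) → refl })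

edge : Graph V → V → V → Bool
edge G u v = does (Adj? G u v)

edge-sym : ∀ (G : Graph V) u v → edge G u v ≡ edge G v u
edge-sym G u v = does-⇔ (mk⇔ (Adj-sym G) (Adj-sym G)) (Adj? G u v) (Adj? G v u)

edge-irrefl : ∀ (G : Graph V) v → edge G v v ≡ false
edge-irrefl G v = dec-false (Adj? G v v) (irrefl G v)

TwinFree : ∀ {m} → Graph V → Fin m ↔ V → Set
TwinFree F ι = ∀ i j → (∀ k → edge F (to i) (to k) ≡ edge F (to j) (to k)) → i ≡ j
  where open Inverse ι

twinFree? : ∀ {m} (F : Graph V) (ι : Fin m ↔ V) → Dec (TwinFree F ι)
twinFree? F ι = all? λ i → all? λ j →
  all? (λ k → edge F (to i) (to k) Bool.≟ edge F (to j) (to k)) →-dec (i ≟ j)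
  where open Inverse ι

module _ {n} (G : Graph (Fin n)) where

  -- Without twins in F, adjacency alone forces f to be injective.
  embedding⇒ContainsInduced : ∀ {m} (F : Graph V) (ι : Fin m ↔ V) → TwinFree F ι →
    (f : Fin m → Fin n) →
    (∀ i j → edge G (f i) (f j) ≡ edge F (Inverse.to ι i) (Inverse.to ι j)) →
    G ContainsInduced F
  embedding⇒ContainsInduced {m = m} F ι twinFree f agrees = S , record
    { bijection = mk↔ₛ′ (to ∘ proj₁ ∘ preimage)
        (λ w → f (from w) , image (from w))
        (λ w → trans (cong to (f-injective (proj₂ (preimage (f (from w) , image (from w))))))
                     (strictlyInverseˡ w))
        (λ x → ∈S-≡ (trans (cong f (strictlyInverseʳ (proj₁ (preimage x)))) (proj₂ (preimage x))))
    ; adjacency = λ x y →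
        subst₂ (λ u v → Adj G u v ⇔ Adj F (to (proj₁ (preimage x))) (to (proj₁ (preimage y))))
          (proj₂ (preimage x)) (proj₂ (preimage y))
          (does-≡⇒⇔ (Adj? G _ _) (Adj? F _ _) (agrees _ _))
    }
    where
    open Inverse ι

    f-injective : ∀ {i j} → f i ≡ f j → i ≡ j
    f-injective {i} {j} fi≡fj = twinFree i j λ k →
      trans (sym (agrees i k)) (trans (cong (λ v → edge G v (f k)) fi≡fj) (agrees j k))

    inImage? : ∀ v → Dec (∃[ i ] f i ≡ v)
    inImage? v = any? λ i → f i ≟ v

    S : Subset n
    S = tabulate (does ∘ inImage?)

    image : ∀ i → f i Subset.∈ S
    image i = lookup⇒[]= (f i) S
      (trans (lookup∘tabulate (does ∘ inImage?) (f i)) (dec-true (inImage? (f i)) (i , refl)))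

    preimage : (x : ∃ (Subset._∈ S)) → ∃[ i ] f i ≡ proj₁ x
    preimage (v , v∈S) with inImage? v | trans (sym (lookup∘tabulate (does ∘ inImage?) v)) ([]=⇒lookup v∈S)
    ... | yes p | _ = p

    ∈S-≡ : {x y : ∃ (Subset._∈ S)} → proj₁ x ≡ proj₁ y → x ≡ y
    ∈S-≡ {_ , p} {_ , q} refl = cong (_ ,_) ([]=-irrelevant p q)

  IsCycle : (Fin 5 → Fin n) → Set
  IsCycle c = ∀ i j → edge G (c i) (c j) ≡ cyc i j

  -- A record rather than a function type, so that the cycle, the vertex and the role can be
  -- inferred from its elements.
  record HasRole (c : Fin 5 → Fin n) (x : Fin n) (p : Role) : Set where
    constructor traces
    field
      trace : ∀ i → edge G x (c i) ≡ adj p (A i)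

  fourVertices⇒ContainsInduced : ∀ (F : Graph V) (ι : Fin 4 ↔ V) → TwinFree F ι → ∀ a b c d →
    let eᶠ = λ i j → edge F (Inverse.to ι i) (Inverse.to ι j) in
    edge G a b ≡ eᶠ 0F 1F → edge G c d ≡ eᶠ 2F 3F → edge G a c ≡ eᶠ 0F 2F →
    edge G a d ≡ eᶠ 0F 3F → edge G b c ≡ eᶠ 1F 2F → edge G b d ≡ eᶠ 1F 3F →
    G ContainsInduced F
  fourVertices⇒ContainsInduced F ι twinFree a b c d ab cd ac ad bc bd =
    embedding⇒ContainsInduced F ι twinFree (lookup (a ∷ b ∷ c ∷ d ∷ [])) λ
      { 0F 0F → loop ; 0F 1F → ab ; 0F 2F → ac ; 0F 3F → ad
      ; 1F 0F → flip ab ; 1F 1F → loop ; 1F 2F → bc ; 1F 3F → bd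
      ; 2F 0F → flip ac ; 2F 1F → flip bc ; 2F 2F → loop ; 2F 3F → cd
      ; 3F 0F → flip ad ; 3F 1F → flip bd ; 3F 2F → flip cd ; 3F 3F → loop }
    where
    loop : ∀ {v x} → edge G v v ≡ edge F x x
    loop = trans (edge-irrefl G _) (sym (edge-irrefl F _))
    flip : ∀ {u v x y} → edge G u v ≡ edge F x y → edge G v u ≡ edge F y x
    flip uv = trans (edge-sym G _ _) (trans uv (edge-sym F _ _))

  H₄-embedding : ∀ c x → IsCycle c →
    (∀ i → edge G x (c i) ≡ edge H₄ nothing (just i)) → G ContainsInduced H₄
  H₄-embedding c x cycle row =
    embedding⇒ContainsInduced H₄ Maybe↔ (from-yes (twinFree? H₄ Maybe↔)) f λ
      { zero zero → edge-irrefl G x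
      ; zero (suc i) → row i
      ; (suc i) zero → trans (edge-sym G (c i) x) (row i)
      ; (suc i) (suc j) → cycle i j }
    where
    f : Fin 6 → Fin n
    f zero = x
    f (suc i) = c i

open HasRole public

-- The structure of graphs containing W₅

-- All that the recolouring uses of the graph. For the classes A only the representatives on the
-- cycle need to be complete to neighbouring classes: this lets a whole class copy the colour of its
-- representative.
record Structure {n} (G : Graph (Fin n)) : Set where
  field
    role  : Fin n → Role
    cycle : Fin 5 → Fin n
    hub   : Fin n
    role-cycle : ∀ i → role (cycle i) ≡ A i
    role-hub   : role hub ≡ W
    role-adj   : ∀ {u v} → Adj G u v → adj (role u) (role v) ≡ true
    A-complete : ∀ {u} i → adj (role u) (A i) ≡ true → Adj G u (cycle i)
    Y-complete : ∀ {u v i j} → role u ≡ Y i → role v ≡ Y j → cyc i j ≡ true → Adj G u v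
    Z-hub      : ∀ {z y i} → role z ≡ Z → role y ≡ Y i → Adj G z y → Adj G z hub

rotateStructure : ∀ {n} {G : Graph (Fin n)} → Fin 5 → Structure G → Structure G
rotateStructure {G = G} k S = record
  { role       = rotate k ∘ role
  ; cycle      = λ i → cycle (⊖ k ⊕ i)
  ; hub        = hub
  ; role-cycle = λ i → trans (cong (rotate k) (role-cycle (⊖ k ⊕ i))) (cong A (⊕-⊖ k i))
  ; role-hub   = cong (rotate k) role-hub
  ; role-adj   = λ {u} {v} uv → trans (adj-rotate k (role u) (role v)) (role-adj uv)
  ; A-complete = λ {u} i h → A-complete (⊖ k ⊕ i) (trans (sym (adj-rotate k (role u) _))
                   (trans (cong (λ j → adj (rotate k (role u)) (A j)) (⊕-⊖ k i)) h))
  ; Y-complete = λ {u} {v} {i} {j} u∈Yi v∈Yj h → Y-complete (unrotate u∈Yi) (unrotate v∈Yj)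
                   (trans (adj-rotate (⊖ k) (Y i) (Y j)) h)
  ; Z-hub      = λ z∈Z y∈Yi → Z-hub (unrotate z∈Z) (unrotate y∈Yi)
  }
  where
  open Structure S
  unrotate : ∀ {u r} → rotate k (role u) ≡ r → role u ≡ rotate (⊖ k) r
  unrotate {u} h = trans (sym (rotate-⊖ k (role u))) (cong (rotate (⊖ k)) h)

module _ {n} {G : Graph (Fin n)}
  (no-2K₂ : G FreeOf 2K₂) (no-K₄ : G FreeOf K 4) (no-H₄ : G FreeOf H₄) where

  private
    e : Fin n → Fin n → Bool
    e = edge G

    flip : ∀ {u v b} → e u v ≡ b → e v u ≡ b
    flip {u} {v} = trans (edge-sym G v u)

    no-2K₂′ : ∀ a b c d → e a b ≡ true → e c d ≡ true →
      e a c ≡ false → e a d ≡ false → e b c ≡ false → e b d ≡ false → ⊥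
    no-2K₂′ a b c d ab cd ac ad bc bd = no-2K₂ (fourVertices⇒ContainsInduced G 2K₂ (+↔⊎ {2} {2})
      (from-yes (twinFree? 2K₂ (+↔⊎ {2} {2}))) a b c d ab cd ac ad bc bd)

    no-K₄′ : ∀ a b c d → e a b ≡ true → e c d ≡ true →
      e a c ≡ true → e a d ≡ true → e b c ≡ true → e b d ≡ true → ⊥
    no-K₄′ a b c d ab cd ac ad bc bd = no-K₄ (fourVertices⇒ContainsInduced G (K 4) (↔-id _)
      (from-yes (twinFree? (K 4) (↔-id _))) a b c d ab cd ac ad bc bd)

  module _ {c} (c-cycle : IsCycle G c) where

    hasRole : ∀ x → ∃[ p ] HasRole G c x p
    hasRole x = map₂ traces (realised (λ i → e x (c i)) dominating missing)
      where
      dominating : ∀ i → e x (c i) ≡ true → e x (c (2F ⊕ i)) ≡ true ⊎ e x (c (3F ⊕ i)) ≡ true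
      dominating i xi with e x (c (2F ⊕ i)) in x2 | e x (c (3F ⊕ i)) in x3
      ... | true | _ = inj₁ refl
      ... | false | true = inj₂ refl
      -- The edge from `x` to vᵢ and the opposite cycle edge vᵢ₊₂ vᵢ₊₃ would induce 2K₂.
      ... | false | false = ⊥-elim (no-2K₂′ x (c i) (c (2F ⊕ i)) (c (3F ⊕ i)) xi
           (trans (c-cycle _ _) (from-yes (all? λ i → cyc (2F ⊕ i) (3F ⊕ i) Bool.≟ true) i)) x2 x3
           (trans (c-cycle _ _) (from-yes (all? λ i → cyc i (2F ⊕ i) Bool.≟ false) i))
           (trans (c-cycle _ _) (from-yes (all? λ i → cyc i (3F ⊕ i) Bool.≟ false) i)))

      missing : ∀ k → ¬ (∀ i → e x (c i) ≡ not (does (k ≟ i)))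
      -- The cycle is read from its missed vertex `k`, because the new vertex of `H₄` misses `zero`.
      missing k h = no-H₄ (H₄-embedding G (λ i → c (k ⊕ i)) x
        (λ i j → trans (c-cycle _ _) (adj-rotate k (A i) (A j)))
        (λ i → trans (h (k ⊕ i)) (from-yes (all? λ k → all? λ i →
          not (does (k ≟ k ⊕ i)) Bool.≟ edge H₄ nothing (just i)) k i)))

    -- Both vertices see the adjacent pair vᵢ₊₂, vᵢ₊₃, so an edge between them would complete a K₄.
    W≁Y : ∀ {w y} i → HasRole G c w W → HasRole G c y (Y i) → e w y ≡ false
    W≁Y {w} {y} i w∈W y∈Y = Bool.¬-not λ wy → no-K₄′ w y (c (2F ⊕ i)) (c (3F ⊕ i)) wy
      (trans (c-cycle _ _) (from-yes (all? λ i → cyc (2F ⊕ i) (3F ⊕ i) Bool.≟ true) i))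
      (trace w∈W _) (trace w∈W _)
      (trans (trace y∈Y _) (from-yes (all? λ i → adj (Y i) (A (2F ⊕ i)) Bool.≟ true) i))
      (trans (trace y∈Y _) (from-yes (all? λ i → adj (Y i) (A (3F ⊕ i)) Bool.≟ true) i))

    W≁W : ∀ {w w′} → HasRole G c w W → HasRole G c w′ W → e w w′ ≡ false
    W≁W {w} {w′} w∈W w′∈W = Bool.¬-not λ ww′ → no-K₄′ w w′ (c 0F) (c 1F)
      ww′ (c-cycle _ _) (trace w∈W _) (trace w∈W _) (trace w′∈W _) (trace w′∈W _)

    Z≁Z : ∀ {z z′} → HasRole G c z Z → HasRole G c z′ Z → e z z′ ≡ false
    Z≁Z {z} {z′} z∈Z z′∈Z = Bool.¬-not λ zz′ → no-2K₂′ z z′ (c 0F) (c 1F)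
      zz′ (c-cycle _ _) (trace z∈Z _) (trace z∈Z _) (trace z′∈Z _) (trace z′∈Z _)

  module _ {c} (c-cycle : IsCycle G c) {x i} (x∈A : HasRole G c x (A i)) where

    swap : Fin 5 → Fin n
    swap j with i ≟ j
    ... | yes _ = x
    ... | no _ = c j

    swap-cycle : IsCycle G swap
    swap-cycle j k with i ≟ j | i ≟ k
    ... | yes refl | yes refl =
      trans (edge-irrefl G x) (sym (from-yes (all? λ i → cyc i i Bool.≟ false) i))
    ... | yes refl | no _ = trace x∈A k
    ... | no _ | yes refl = trans (flip (trace x∈A j)) (adj-sym (A i) (A j))
    ... | no _ | no _ = c-cycle j k

    swap-at : swap i ≡ x
    swap-at with i ≟ i
    ... | yes _ = refl
    ... | no i≢i = contradiction refl i≢i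

    swap-off : ∀ {j} → i ≢ j → swap j ≡ c j
    swap-off {j} i≢j with i ≟ j
    ... | yes i≡j = contradiction i≡j i≢j
    ... | no _ = refl

    -- The traces on the old and the new cycle agree away from `i`, so only a change between an A
    -- and a Y remains to be excluded. Once the role is kept, `u` sees `x` exactly as its role
    -- prescribes for vᵢ.
    swap-hasRole : ∀ {u p} → HasRole G c u p →
      (∀ {q} → HasRole G swap u q → Compatible p q ≡ true) → HasRole G swap u p
    swap-hasRole {u} {p} u∈p compatible = subst (HasRole G swap u) (sym p≡q) u∈q
      where
      q = proj₁ (hasRole swap-cycle u)
      u∈q = proj₂ (hasRole swap-cycle u)
      p≡q : p ≡ q
      p≡q = role-determined i p q
        (λ j i≢j → trans (sym (trace u∈p j)) (trans (sym (cong (e u) (swap-off i≢j))) (trace u∈q j)))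
        (compatible u∈q)

    swap-edge : ∀ {u p} → HasRole G swap u p → e u x ≡ adj p (A i)
    swap-edge {u} u∈p = trans (sym (cong (e u) swap-at)) (trace u∈p i)

    swap-W : ∀ {w} → HasRole G c w W → HasRole G swap w W
    swap-W w∈W = swap-hasRole w∈W λ _ → refl

  -- The role `W` survives every swap, so `w` sees all of the new cycle, of which `x` is a member.
  W~A : ∀ {c} → IsCycle G c → ∀ {w x i} → HasRole G c w W → HasRole G c x (A i) → e w x ≡ true
  W~A c-cycle w∈W x∈A = swap-edge c-cycle x∈A (swap-W c-cycle x∈A w∈W)

  module _ {c} (c-cycle : IsCycle G c) {w} (w∈W : HasRole G c w W) where

    -- The vertex `w` tells A from Y relative to the old and the new cycle alike, being complete to
    -- A by `W~A` and anticomplete to Y by `W≁Y`. Hence swapping in `x` changes no role.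
    A-edge : ∀ {x u i p} → HasRole G c x (A i) → HasRole G c u p → e u x ≡ adj p (A i)
    A-edge {x} {u} {i} {p} x∈A u∈p =
      swap-edge c-cycle x∈A (swap-hasRole c-cycle x∈A u∈p (λ {q} → compatible p u∈p q))
      where
      compatible : ∀ p → HasRole G c u p → ∀ q → HasRole G (swap c-cycle x∈A) u q → Compatible p q ≡ true
      compatible (A _) u∈p (Y j) u∈q =
        trans (sym (W≁Y (swap-cycle c-cycle x∈A) j (swap-W c-cycle x∈A w∈W) u∈q)) (W~A c-cycle w∈W u∈p)
      compatible (Y j) u∈p (A _) u∈q =
        trans (sym (W≁Y c-cycle j w∈W u∈p)) (W~A (swap-cycle c-cycle x∈A) (swap-W c-cycle x∈A w∈W) u∈q)
      compatible (A _) _ (A _) _ = refl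
      compatible (A _) _ W _ = refl
      compatible (A _) _ Z _ = refl
      compatible (Y _) _ (Y _) _ = refl
      compatible (Y _) _ W _ = refl
      compatible (Y _) _ Z _ = refl
      compatible W _ _ _ = refl
      compatible Z _ _ _ = refl

    -- Some cycle neighbour k of both i and j is missed by `y` and by `y′`. An edge y y′ would
    -- therefore induce 2K₂ together with the edge w vₖ.
    Y≁Y : ∀ {y y′} i j → cyc i j ≡ false → HasRole G c y (Y i) → HasRole G c y′ (Y j) → e y y′ ≡ false
    Y≁Y {y} {y′} i j ij y∈Y y′∈Y with from-yes (all? λ i → all? λ j → (cyc i j Bool.≟ false) →-dec
        any? λ k → (adj (Y i) (A k) Bool.≟ false) ×-dec (adj (Y j) (A k) Bool.≟ false)) i j ij
    ... | k , ik , jk = Bool.¬-not λ yy′ → no-2K₂′ y y′ w (c k) yy′ (trace w∈W k)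
      (flip (W≁Y c-cycle i w∈W y∈Y)) (trans (trace y∈Y k) ik)
      (flip (W≁Y c-cycle j w∈W y′∈Y)) (trans (trace y′∈Y k) jk)

    -- For j = i + 1 the edges y vᵢ₊₂ and y′ vᵢ₋₁ would otherwise induce 2K₂; the case j = i - 1 is
    -- its mirror image.
    Y~Y : ∀ {y y′} i j → cyc i j ≡ true → HasRole G c y (Y i) → HasRole G c y′ (Y j) → e y y′ ≡ true
    Y~Y {y} {y′} i j ij y∈Y y′∈Y with from-yes (all? λ i → all? λ j → (cyc i j Bool.≟ true) →-dec
        any? λ k → any? λ l → (adj (Y i) (A k) Bool.≟ true) ×-dec (adj (Y j) (A l) Bool.≟ true) ×-dec
          (adj (Y i) (A l) Bool.≟ false) ×-dec (adj (A k) (Y j) Bool.≟ false) ×-dec (cyc k l Bool.≟ false)) i j ij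
    ... | k , l , ik , jl , il , kj , kl = Bool.¬-not λ yy′ → no-2K₂′ y (c k) y′ (c l)
      (trans (trace y∈Y k) ik) (trans (trace y′∈Y l) jl) yy′ (trans (trace y∈Y l) il)
      (flip (trans (trace y′∈Y k) (trans (adj-sym (Y j) (A k)) kj))) (trans (c-cycle k l) kl)

    -- As `y` misses vᵢ₊₁, the edges z y and w vᵢ₊₁ would otherwise induce 2K₂.
    Z~Y⇒Z~W : ∀ {z y} i → HasRole G c z Z → HasRole G c y (Y i) → e z y ≡ true → e z w ≡ true
    Z~Y⇒Z~W {z} {y} i z∈Z y∈Y zy = Bool.¬-not λ zw → no-2K₂′ z y w (c (1F ⊕ i)) zy (trace w∈W _) zw
      (trace z∈Z _) (flip (W≁Y c-cycle i w∈W y∈Y))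
      (trans (trace y∈Y _) (from-yes (all? λ i → adj (Y i) (A (1F ⊕ i)) Bool.≟ false) i))

    edge⇒adj : ∀ {u v} p q → HasRole G c u p → HasRole G c v q → e u v ≡ true → adj p q ≡ true
    edge⇒adj (A i) q u∈p v∈q uv =
      trans (adj-sym (A i) q) (trans (sym (A-edge u∈p v∈q)) (flip uv))
    edge⇒adj p@(Y _) (A _) u∈p v∈q uv = trans (sym (A-edge v∈q u∈p)) uv
    edge⇒adj W (A _) u∈p v∈q uv = refl
    edge⇒adj p@Z (A _) u∈p v∈q uv = trans (sym (A-edge v∈q u∈p)) uv
    edge⇒adj (Y i) (Y j) u∈p v∈q uv with cyc i j in ij
    ... | true = refl
    ... | false = trans (sym (Y≁Y i j ij u∈p v∈q)) uv
    edge⇒adj (Y i) W u∈p v∈q uv = trans (sym (W≁Y c-cycle i v∈q u∈p)) (flip uv)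
    edge⇒adj (Y _) Z _ _ _ = refl
    edge⇒adj W (Y i) u∈p v∈q uv = trans (sym (W≁Y c-cycle i u∈p v∈q)) uv
    edge⇒adj W W u∈p v∈q uv = trans (sym (W≁W c-cycle u∈p v∈q)) uv
    edge⇒adj W Z _ _ _ = refl
    edge⇒adj Z (Y _) _ _ _ = refl
    edge⇒adj Z W _ _ _ = refl
    edge⇒adj Z Z u∈p v∈q uv = trans (sym (Z≁Z c-cycle u∈p v∈q)) uv

    structure : Structure G
    structure = record
      { role       = role
      ; cycle      = c
      ; hub        = w
      ; role-cycle = λ i → unique (hasRole-role (c i)) (traces (c-cycle i))
      ; role-hub   = unique (hasRole-role w) w∈W
      ; role-adj   = λ uv → edge⇒adj _ _ (hasRole-role _) (hasRole-role _) (dec-true (Adj? G _ _) uv)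
      ; A-complete = λ {u} i h → edge⇒Adj (trans (trace (hasRole-role u) i) h)
      ; Y-complete = λ u∈Yi v∈Yj h → edge⇒Adj (Y~Y _ _ h (inRole u∈Yi) (inRole v∈Yj))
      ; Z-hub      = λ z∈Z y∈Yi zy → edge⇒Adj (Z~Y⇒Z~W _ (inRole z∈Z) (inRole y∈Yi) (dec-true (Adj? G _ _) zy))
      }
      where
      role : Fin n → Role
      role u = proj₁ (hasRole c-cycle u)
      hasRole-role : ∀ u → HasRole G c u (role u)
      hasRole-role u = proj₂ (hasRole c-cycle u)
      inRole : ∀ {u r} → role u ≡ r → HasRole G c u r
      inRole {u} refl = hasRole-role u
      edge⇒Adj : ∀ {u v} → e u v ≡ true → Adj G u v
      edge⇒Adj {u} {v} uv = Equivalence.from (does-≡⇒⇔ (Adj? G u v) (yes tt) uv) tt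
      unique : ∀ {u p q} → HasRole G c u p → HasRole G c u q → p ≡ q
      unique {p = p} {q} u∈p u∈q = from-yes (allRoles? λ p → allRoles? λ q →
        all? (λ j → adj p (A j) Bool.≟ adj q (A j)) →-dec (p ≟ᴿ q)) p q
        λ j → trans (sym (trace u∈p j)) (trace u∈q j)

  containsW₅⇒structure : G ContainsInduced W₅ → Structure G
  containsW₅⇒structure (S , iso) =
    structure (λ i j → agrees (just i) (just j))
              (traces λ i → trans (agrees nothing (just i)) (from-yes (all? λ i → edge W₅ nothing (just i) Bool.≟ true) i))
    where
    open _≅_ iso
    open Inverse bijection
    vertex : Maybe (Fin 5) → Fin n
    vertex a = proj₁ (from a)
    agrees : ∀ a b → e (vertex a) (vertex b) ≡ edge W₅ a b
    agrees a b = does-⇔ (subst₂ (λ x y → Adj G (vertex a) (vertex b) ⇔ Adj W₅ x y)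
      (strictlyInverseˡ a) (strictlyInverseˡ b) (adjacency (from a) (from b))) (Adj? G _ _) (Adj? W₅ a b)

-- Paths between colourings

-- If `f` hit every colour, choosing preimages would inject ℓ colours into m places.
fresh : ∀ {m ℓ} → m < ℓ → (f : Fin m → Fin ℓ) → ∃[ δ ] (∀ i → f i ≢ δ)
fresh {m} {ℓ} m<ℓ f with any? (λ δ → all? (λ i → ¬? (f i ≟ δ)))
... | yes found = found
... | no ¬found = contradiction (injective⇒≤ section-injective) (<⇒≱ m<ℓ)
  where
  hit : ∀ δ → ∃[ i ] f i ≡ δ
  hit δ with any? (λ i → f i ≟ δ)
  ... | yes p = p
  ... | no ¬p = contradiction (δ , λ i fi≡δ → ¬p (i , fi≡δ)) ¬found
  section-injective : Injective _≡_ _≡_ (proj₁ ∘ hit)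
  section-injective {γ} {δ} eq = trans (sym (proj₂ (hit γ))) (trans (cong f eq) (proj₂ (hit δ)))

fresh₄ : ∀ {ℓ} → 4 < ℓ → (a b c d : Fin ℓ) → ∃[ δ ] (a ≢ δ × b ≢ δ × c ≢ δ × d ≢ δ)
fresh₄ 4<ℓ a b c d with fresh 4<ℓ (λ { 0F → a ; 1F → b ; 2F → c ; 3F → d })
... | δ , f = δ , f 0F , f 1F , f 2F , f 3F

module _ {n} {G : Graph (Fin n)} {ℓ : ℕ} where

  private
    R = reconfigurationGraph G ℓ

  colouringOf : (f : Fin n → Fin ℓ) → (∀ {u v} → Adj G u v → f u ≢ f v) → Colouring G ℓ
  colouringOf f f-proper = record
    { colours = tabulate f
    ; proper  = λ u v uv → subst₂ _≢_ (sym (lookup∘tabulate f u)) (sym (lookup∘tabulate f v)) (f-proper uv)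
    }

  colour-colouringOf : ∀ f (f-proper : ∀ {u v} → Adj G u v → f u ≢ f v) u →
    colour (colouringOf f f-proper) u ≡ f u
  colour-colouringOf f _ = lookup∘tabulate f

  -- Two colourings with the same colours need not be equal, their properness
  -- proofs may differ; hence the end of a path is only fixed up to `colours`.
  record Path (c d : Colouring G ℓ) : Set where
    constructor path
    field
      {end}  : Colouring G ℓ
      steps  : Star (Adj R) c end
      arrive : colours end ≡ colours d

  ≗⇒Path : ∀ {c d : Colouring G ℓ} → (∀ u → colour c u ≡ colour d u) → Path c d
  ≗⇒Path h = path ε (trans (sym (tabulate∘lookup _)) (trans (tabulate-cong h) (tabulate∘lookup _)))

  Adj-respˡ : ∀ {c c′} d → colours c ≡ colours c′ → Adj R c d → Adj R c′ d
  Adj-respˡ d = subst λ cs → ∃! _≡_ (λ v → lookup cs v ≢ colour d v)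

  Path-respˡ : ∀ {c c′ d : Colouring G ℓ} → colours c ≡ colours c′ → Path c d → Path c′ d
  Path-respˡ eq (path ε eq′) = path ε (trans (sym eq) eq′)
  Path-respˡ {c} {c′} eq (path (_◅_ {j = e} step steps) eq′) =
    path (Adj-respˡ {c} {c′} e eq step ◅ steps) eq′

  Path-trans : ∀ {c d e : Colouring G ℓ} → Path c d → Path d e → Path c e
  Path-trans (path steps eq) d⟶e with Path-respˡ (sym eq) d⟶e
  ... | path steps′ eq′ = path (steps ◅◅ steps′) eq′

  Path-sym : ∀ {c d : Colouring G ℓ} → Path c d → Path d c
  Path-sym (path steps eq) = Path-respˡ eq (reverse steps)
    where
    reverse : ∀ {c d : Colouring G ℓ} → Star (Adj R) c d → Path d c
    reverse ε = path ε refl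
    reverse {c} (_◅_ {j = e} step steps) =
      Path-trans (reverse steps) (path (_◅_ {j = c} (Adj-sym R {c} {e} step) ε) refl)

  module _ (c d : Colouring G ℓ)
           (compatible : ∀ {u v} → Adj G u v → colour c u ≢ colour d v) where

    open DecMembership {A = Fin n} _≟_ using (_∈?_)

    private
      mix : List (Fin n) → Fin n → Fin ℓ
      mix us u with u ∈? us
      ... | yes _ = colour d u
      ... | no _ = colour c u

      mix-proper : ∀ us {u v} → Adj G u v → mix us u ≢ mix us v
      mix-proper us {u} {v} uv with u ∈? us | v ∈? us
      ... | yes _ | yes _ = proper d u v uv
      ... | yes _ | no _ = compatible (Adj-sym G uv) ∘ sym
      ... | no _ | yes _ = compatible uv
      ... | no _ | no _ = proper c u v uv

      mixed : List (Fin n) → Colouring G ℓ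
      mixed us = colouringOf (mix us) (mix-proper us)

      mixed-∈ : ∀ us {u} → u ∈ us → colour (mixed us) u ≡ colour d u
      mixed-∈ us {u} u∈us with u ∈? us | colour-colouringOf (mix us) (mix-proper us) u
      ... | yes _ | eq = eq
      ... | no u∉us | _ = contradiction u∈us u∉us

      mixed-∉ : ∀ us {u} → u ∉ us → colour (mixed us) u ≡ colour c u
      mixed-∉ us {u} u∉us with u ∈? us | colour-colouringOf (mix us) (mix-proper us) u
      ... | no _ | eq = eq
      ... | yes u∈us | _ = contradiction u∈us u∉us

      mixed-agree : ∀ x us {u} → x ≢ u → colour (mixed us) u ≡ colour (mixed (x ∷ us)) u
      mixed-agree x us {u} x≢u with u ∈? us
      ... | yes u∈us = trans (mixed-∈ us u∈us) (sym (mixed-∈ (x ∷ us) (there u∈us)))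
      ... | no u∉us = trans (mixed-∉ us u∉us)
        (sym (mixed-∉ (x ∷ us) λ { (here u≡x) → x≢u (sym u≡x) ; (there u∈us) → u∉us u∈us }))

      mixed-step : ∀ x us → Path (mixed us) (mixed (x ∷ us))
      mixed-step x us with colour (mixed us) x ≟ colour (mixed (x ∷ us)) x
      -- Nothing changes at `x`, and equal colourings are not adjacent, so the path stays where it
      -- is.
      ... | yes same = ≗⇒Path agree
        where
        agree : ∀ u → colour (mixed us) u ≡ colour (mixed (x ∷ us)) u
        agree u with x ≟ u
        ... | yes refl = same
        ... | no x≢u = mixed-agree x us x≢u
      ... | no differ = path (_◅_ {j = mixed (x ∷ us)} (x , differ , unique) ε) refl
        where
        unique : ∀ {u} → colour (mixed us) u ≢ colour (mixed (x ∷ us)) u → x ≡ u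
        unique {u} h = decidable-stable (x ≟ u) λ x≢u → h (mixed-agree x us x≢u)

      mixed-path : ∀ us → Path c (mixed us)
      mixed-path [] = ≗⇒Path λ u → sym (mixed-∉ [] λ ())
      mixed-path (x ∷ us) = Path-trans (mixed-path us) (mixed-step x us)

    -- Switching from c to d one vertex at a time, in any order, stays proper.
    compatible⇒Path : Path c d
    compatible⇒Path =
      Path-trans (mixed-path (allFin n)) (≗⇒Path λ u → mixed-∈ (allFin n) (∈-allFin u))

  private
    -- Adjacency depends on the colours alone, so the last step of the path can be redirected to `d`
    -- itself. Distinct colours guarantee that there is a last step.
    Path⇒Star : ∀ {c d : Colouring G ℓ} → colours c ≢ colours d → Path c d → Star (Adj R) c d
    Path⇒Star c≢d (path ε eq) = contradiction eq c≢d
    Path⇒Star {c} {d} _ (path {d′} (step ◅ steps) eq) = redirect step steps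
      where
      redirect : ∀ {c e : Colouring G ℓ} → Adj R c e → Star (Adj R) e d′ → Star (Adj R) c d
      redirect {c} step ε = Adj-sym R {d} {c} (Adj-respˡ {d′} {d} c eq (Adj-sym R {c} {d′} step)) ◅ ε
      redirect {c} {e} step (_◅_ {j = f} step′ steps) =
        _◅_ {j = e} step (redirect {e} {f} step′ steps)

  -- If c and d have the same colours, the walk makes a detour through a
  -- different colouring.
  Path⇒Connected : (∀ c d → Path c d) → (∀ c → ∃[ d ] colours c ≢ colours {G = G} d) → Connected R
  Path⇒Connected paths another c d with ≡-dec _≟_ (colours c) (colours d)
  ... | no c≢d = Path⇒Star c≢d (paths c d)
  ... | yes c≡d with another c
  ...   | e , c≢e = Path⇒Star c≢e (paths c e)
          ◅◅ Path⇒Star (λ e≡d → c≢e (trans c≡d (sym e≡d))) (paths e d)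

-- Recolouring to a fixed partition

open DecMembership _≟ᴿ_ using (_∈?_)

-- This order is also the one in which `paintRoles` expects the conditions on the neighbours of a
-- role.
allRoles : List Role
allRoles = A 0F ∷ A 1F ∷ A 2F ∷ A 3F ∷ A 4F ∷ Y 0F ∷ Y 1F ∷ Y 2F ∷ Y 3F ∷ Y 4F ∷ W ∷ Z ∷ []

neighbours : Role → List Role
neighbours r = filterᵇ (adj r) allRoles

∈-neighbours : ∀ r s → adj s r ≡ true → s ∈ neighbours r
∈-neighbours = from-yes (allRoles? λ r → allRoles? λ s →
  (adj s r Bool.≟ true) →-dec (s ∈? neighbours r))

Independent : List Role → Set
Independent X = All (λ r → All (λ s → adj r s ≡ false) X) X

independent? : ∀ X → Dec (Independent X)
independent? X = All.all? (λ r → All.all? (λ s → adj r s Bool.≟ false) X) X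

≡-≢ : ∀ {A : Set} {x y z : A} → y ≢ z → x ≡ y → x ≢ z
≡-≢ y≢z refl = y≢z

-- A prism with an apex: the quotient of the roles left to colour once Y₀ and
-- Y₂ share the colour of W.
data Part : Set where
  apex : Part
  top bottom : Fin 3 → Part

_≟ᴾ_ : DecidableEquality Part
apex ≟ᴾ apex = yes refl
apex ≟ᴾ top _ = no λ ()
apex ≟ᴾ bottom _ = no λ ()
top _ ≟ᴾ apex = no λ ()
top i ≟ᴾ top j = map′ (cong top) (λ { refl → refl }) (i ≟ j)
top _ ≟ᴾ bottom _ = no λ ()
bottom _ ≟ᴾ apex = no λ ()
bottom _ ≟ᴾ top _ = no λ ()
bottom i ≟ᴾ bottom j = map′ (cong bottom) (λ { refl → refl }) (i ≟ j)

joined : Part → Part → Bool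
joined apex apex = false
joined apex _ = true
joined _ apex = true
joined (top i) (top j) = not (does (i ≟ j))
joined (bottom i) (bottom j) = not (does (i ≟ j))
joined (top i) (bottom j) = does (i ≟ j)
joined (bottom i) (top j) = does (i ≟ j)

part : Role → Part
part (A 0F) = bottom 2F
part (A 1F) = bottom 0F
part (A 2F) = bottom 1F
part (A 3F) = top 1F
part (A 4F) = top 2F
part (Y 0F) = apex
part (Y 1F) = top 0F
part (Y 2F) = apex
part (Y 3F) = bottom 1F
part (Y 4F) = bottom 2F
part W = apex
part Z = bottom 0F

part-joined : ∀ r s → adj r s ≡ true → joined (part r) (part s) ≡ true
part-joined = from-yes (allRoles? λ r → allRoles? λ s →
  (adj r s Bool.≟ true) →-dec (joined (part r) (part s) Bool.≟ true))

-- The colour classes of κ are four disjoint faces of the icosahedron.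
κᴾ : Part → Fin 4
κᴾ apex = 0F
κᴾ (top 0F) = 1F
κᴾ (top 1F) = 2F
κᴾ (top 2F) = 3F
κᴾ (bottom 0F) = 2F
κᴾ (bottom 1F) = 3F
κᴾ (bottom 2F) = 1F

κ : Role → Fin 4
κ = κᴾ ∘ part

partition : ∀ {ℓ} (α x₀ x₁ x₂ y₀ y₁ y₂ : Fin ℓ) → Part → Fin ℓ
partition α x₀ x₁ x₂ y₀ y₁ y₂ apex = α
partition α x₀ x₁ x₂ y₀ y₁ y₂ (top 0F) = x₀
partition α x₀ x₁ x₂ y₀ y₁ y₂ (top 1F) = x₁
partition α x₀ x₁ x₂ y₀ y₁ y₂ (top 2F) = x₂
partition α x₀ x₁ x₂ y₀ y₁ y₂ (bottom 0F) = y₀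
partition α x₀ x₁ x₂ y₀ y₁ y₂ (bottom 1F) = y₁
partition α x₀ x₁ x₂ y₀ y₁ y₂ (bottom 2F) = y₂

κ-proper : ∀ r s → adj r s ≡ true → κ r ≢ κ s
κ-proper = from-yes (allRoles? λ r → allRoles? λ s →
  (adj r s Bool.≟ true) →-dec ¬? (κ r ≟ κ s))

≟-does-sym : ∀ {m} (i j : Fin m) → does (i ≟ j) ≡ does (j ≟ i)
≟-does-sym i j = does-⇔ (mk⇔ sym sym) (i ≟ j) (j ≟ i)

joined-sym : ∀ s t → joined s t ≡ true → joined t s ≡ true
joined-sym apex (top _) _ = refl
joined-sym apex (bottom _) _ = refl
joined-sym (top _) apex _ = refl
joined-sym (bottom _) apex _ = refl
joined-sym (top i) (top j) h = trans (cong not (≟-does-sym j i)) h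
joined-sym (bottom i) (bottom j) h = trans (cong not (≟-does-sym j i)) h
joined-sym (top i) (bottom j) h = trans (≟-does-sym j i) h
joined-sym (bottom i) (top j) h = trans (≟-does-sym j i) h

Ready : ∀ {ℓ} → (Fin 5 → Fin ℓ) → Fin ℓ → Role → Fin ℓ → Set
Ready a α (A i) x = x ≡ a i
Ready a α (Y 0F) x = x ≡ α
Ready a α (Y 1F) x = x ≢ α
Ready a α (Y 2F) x = x ≡ α
Ready a α (Y 3F) x = x ≢ α
Ready a α (Y 4F) x = x ≢ α
Ready a α W x = x ≡ α
Ready a α Z _ = ⊤

-- Z has to avoid `α` because it may be adjacent to the Y classes that are painted `α` next.
Settled : ∀ {ℓ} → (Fin 5 → Fin ℓ) → Fin ℓ → Role → Fin ℓ → Set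
Settled a α (A i) x = x ≡ a i
Settled a α (Y _) _ = ⊤
Settled a α W x = x ≡ α
Settled a α Z x = x ≢ α

-- Recolouring in stages

module Recolouring {n} {G : Graph (Fin n)} {ℓ} (4<ℓ : 4 < ℓ) where

  -- A stage retains only what is known about the colour of each single vertex; `_>>=_` chains the
  -- stages.
  record Reaches (c : Colouring G ℓ) (P : Fin n → Fin ℓ → Set) : Set where
    constructor reaches
    field
      {end} : Colouring G ℓ
      walk  : Path c end
      holds : ∀ u → P u (colour end u)
  open Reaches

  infixl 1 _>>=_
  _>>=_ : ∀ {c P Q} → Reaches c P → (∀ {d} → (∀ u → P u (colour d u)) → Reaches d Q) → Reaches c Q
  reaches c⟶d h >>= f with f h
  ... | reaches d⟶e h′ = reaches (Path-trans c⟶d d⟶e) h′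

  weaken : ∀ {c P Q} → (∀ u {x} → P u x → Q u x) → Reaches c P → Reaches c Q
  weaken f (reaches w h) = reaches w (λ u → f u (h u))

  switchTo : ∀ {c} (f : Fin n → Fin ℓ) → (∀ {u v} → Adj G u v → f u ≢ f v) →
    (∀ {u v} → Adj G u v → colour c u ≢ f v) → Reaches c (λ u x → x ≡ f u)
  switchTo {c} f f-proper compatible = reaches
    (compatible⇒Path c (colouringOf f f-proper)
      λ {u} {v} uv eq → compatible uv (trans eq (colour-colouringOf {G = G} f f-proper v)))
    (colour-colouringOf {G = G} f f-proper)

  paint : ∀ {c} {X : Fin n → Set} (X? : ∀ u → Dec (X u)) β →
    (∀ {u v} → Adj G u v → X v → colour c u ≢ β × ¬ X u) →
    Reaches c (λ u x → (X u → x ≡ β) × (¬ X u → x ≡ colour c u))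
  paint {c} {X} X? β free = weaken painted (switchTo f f-proper compatible)
    where
    f : Fin n → Fin ℓ
    f u with X? u
    ... | yes _ = β
    ... | no _ = colour c u

    f-proper : ∀ {u v} → Adj G u v → f u ≢ f v
    f-proper {u} {v} uv with X? u | X? v
    ... | yes u∈X | yes v∈X = contradiction u∈X (proj₂ (free uv v∈X))
    ... | yes u∈X | no _ = proj₁ (free (Adj-sym G uv) u∈X) ∘ sym
    ... | no _ | yes v∈X = proj₁ (free uv v∈X)
    ... | no _ | no _ = proper c u v uv

    compatible : ∀ {u v} → Adj G u v → colour c u ≢ f v
    compatible {u} {v} uv with X? v
    ... | yes v∈X = proj₁ (free uv v∈X)
    ... | no _ = proper c u v uv

    painted : ∀ u {x} → x ≡ f u → (X u → x ≡ β) × (¬ X u → x ≡ colour c u)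
    painted u x≡fu with X? u
    ... | yes u∈X = (λ _ → x≡fu) , λ u∉X → contradiction u∈X u∉X
    ... | no u∉X = (λ u∈X → contradiction u∈X u∉X) , λ _ → x≡fu

  -- Colourings pulled back along a homomorphism `place` to a small graph `T`: changing the colour
  -- of one vertex of `T` recolours its whole fibre.
  module Template {T : Set} (_~_ : T → T → Set) (~-sym : ∀ {s t} → s ~ t → t ~ s)
    (_≟ᵀ_ : DecidableEquality T)
    (place : Fin n → T) (place-~ : ∀ {u v} → Adj G u v → place u ~ place v) where

    Proper : (T → Fin ℓ) → Set
    Proper q = ∀ s t → s ~ t → q s ≢ q t

    infix 4 _↝_
    record _↝_ (c : Colouring G ℓ) (q : T → Fin ℓ) : Set where
      constructor _,_
      field
        is-proper : Proper q
        reached   : Reaches c (λ u x → x ≡ q (place u))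
    open _↝_ public

    switch : ∀ {c q q′} → Proper q′ → (∀ s t → s ~ t → q s ≢ q′ t) → c ↝ q → c ↝ q′
    switch {q = q} {q′} q′-proper compatible (_ , r) = q′-proper , (r >>= λ h →
      switchTo (q′ ∘ place) (λ uv → q′-proper _ _ (place-~ uv))
        λ {u} {v} uv → ≡-≢ (compatible _ _ (place-~ uv)) (h u))

    infixl 5 _[_≔_]
    _[_≔_] : (T → Fin ℓ) → T → Fin ℓ → T → Fin ℓ
    (q [ t ≔ β ]) s = if does (t ≟ᵀ s) then β else q s

    move : ∀ {c q} t β → (∀ s → s ~ t → q s ≢ β) → c ↝ q → c ↝ q [ t ≔ β ]
    move {q = q} t β free r@(q-proper , _) = switch updated-proper compatible r
      where
      compatible : ∀ s s′ → s ~ s′ → q s ≢ (q [ t ≔ β ]) s′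
      compatible s s′ s~s′ with t ≟ᵀ s′
      ... | yes refl = free s s~s′
      ... | no _ = q-proper s s′ s~s′

      updated-proper : Proper (q [ t ≔ β ])
      updated-proper s s′ s~s′ with t ≟ᵀ s | t ≟ᵀ s′
      ... | yes refl | yes refl = contradiction refl (q-proper s s s~s′)
      ... | yes refl | no _ = free s′ (~-sym s~s′) ∘ sym
      ... | no _ | yes refl = free s s~s′
      ... | no _ | no _ = q-proper s s′ s~s′

  module WithStructure (S : Structure G) where
    open Structure S

    near : ∀ (d : Colouring G ℓ) {u r} i → role u ≡ r → adj r (A i) ≡ true → colour d u ≢ colour d (cycle i)
    near d {u} i u∈r r~Ai =
      proper d u (cycle i) (A-complete i (trans (cong (λ r → adj r (A i)) u∈r) r~Ai))

    Fits : Colouring G ℓ → (Role → Fin ℓ → Set) → Set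
    Fits c Φ = Reaches c (λ u → Φ (role u))

    -- The test evaluates on concrete roles, so what is known after several paintings is found by
    -- computation.
    repaint : List Role → Fin ℓ → (Role → Fin ℓ → Set) → Role → Fin ℓ → Set
    repaint X β Φ r x = if does (r ∈? X) then x ≡ β else Φ r x

    -- Edges of the graph map to `adj`, so independence of `X` among the roles carries over to the
    -- vertices, and only the neighbouring roles have to avoid `β`.
    paintRoles : ∀ {c} Φ X β → {True (independent? X)} →
      All (λ r → All (λ s → ∀ {x} → Φ s x → x ≢ β) (neighbours r)) X →
      Fits c Φ → Fits c (repaint X β Φ)
    paintRoles Φ X β {indep} free r = r >>= λ {d} h →
      weaken (fits d h) (paint (λ u → role u ∈? X) β λ {u} {v} uv v∈X →
        All.lookup (All.lookup free v∈X) (∈-neighbours _ _ (role-adj uv)) (h u)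
        , λ u∈X → contradiction (trans (sym (role-adj uv)) (All.lookup (All.lookup (toWitness indep) u∈X) v∈X)) λ ())
      where
      fits : ∀ d → (∀ u → Φ (role u) (colour d u)) → ∀ u {x} →
        (role u ∈ X → x ≡ β) × (role u ∉ X → x ≡ colour d u) → repaint X β Φ (role u) x
      fits d h u (on , off) with role u ∈? X
      ... | yes u∈X = on u∈X
      ... | no u∉X = subst (Φ (role u)) (sym (off u∉X)) (h u)

    module PartTemplate = Template (λ s t → joined s t ≡ true) (λ {s} {t} → joined-sym s t) _≟ᴾ_
      (part ∘ role) (λ {u} {v} uv → part-joined (role u) (role v) (role-adj uv))

    module RoleTemplate = Template (λ r s → adj r s ≡ true) (λ {r} {s} h → trans (adj-sym s r) h) _≟ᴿ_
      role role-adj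

    record Canonical (c : Colouring G ℓ) : Set where
      field
        palette : Fin 4 → Fin ℓ
        injective : ∀ {i j} → palette i ≡ palette j → i ≡ j
        canonical : Reaches c (λ u x → x ≡ palette (κ (role u)))

    -- Colourings of the prism with an apex

    module _ where
      open PartTemplate
      private
        t₀ = top 0F
        t₁ = top 1F
        t₂ = top 2F
        b₀ = bottom 0F
        b₁ = bottom 1F
        b₂ = bottom 2F

      -- The bottom triangle repeats the colours of the top one, shifted as in `κᴾ`.
      record Aligned (c : Colouring G ℓ) : Set where
        field
          {colours′} : Part → Fin ℓ
          aligned  : c ↝ colours′
          b₀≡t₁ : colours′ b₀ ≡ colours′ t₁
          b₁≡t₂ : colours′ b₁ ≡ colours′ t₂
          b₂≡t₀ : colours′ b₂ ≡ colours′ t₀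

      -- The moves run from the innermost outwards: b₁, b₂, b₀. The hypothesis frees the first
      -- target colour, and each move vacates the only colour that could block the next.
      align-≢ : ∀ {c q} → q b₀ ≢ q t₂ → c ↝ q → Aligned c
      align-≢ {c} {q} b₀≢t₂ r@(q-proper , _) = record
        { aligned = move b₀ (q t₁) (λ
              { apex _ → q-proper apex t₁ refl
              ; (top 0F) _ → q-proper t₀ t₁ refl
              ; (bottom 1F) _ → q-proper t₂ t₁ refl
              ; (bottom 2F) _ → q-proper t₀ t₁ refl })
          (move b₂ (q t₀) (λ
              { apex _ → q-proper apex t₀ refl
              ; (top 2F) _ → q-proper t₂ t₀ refl
              ; (bottom 0F) _ → q-proper b₀ t₀ refl
              ; (bottom 1F) _ → q-proper t₂ t₀ refl
              ; (bottom 2F) () })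
          (move b₁ (q t₂) (λ
              { apex _ → q-proper apex t₂ refl
              ; (top 1F) _ → q-proper t₁ t₂ refl
              ; (bottom 0F) _ → b₀≢t₂
              ; (bottom 2F) _ → q-proper b₂ t₂ refl }) r))
        ; b₀≡t₁ = refl
        ; b₁≡t₂ = refl
        ; b₂≡t₀ = refl
        }

      -- Only b₀ having the colour of t₂ is an obstacle. If b₂ lacks the colour of t₁, then b₀ can
      -- take that colour; failing this, if b₁ lacks the colour of t₀, then b₂ moves there first.
      align : ∀ {c q} → c ↝ q → Aligned c
      align {c} {q} r@(q-proper , _) with q b₀ ≟ q t₂ | q b₂ ≟ q t₁ | q b₁ ≟ q t₀
      ... | no b₀≢t₂ | _ | _ = align-≢ b₀≢t₂ r
      ... | yes _ | no b₂≢t₁ | _ =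
        align-≢ (q-proper t₁ t₂ refl) (move b₀ (q t₁) (λ
          { apex _ → q-proper apex t₁ refl
          ; (top 0F) _ → q-proper t₀ t₁ refl
          ; (bottom 1F) _ → q-proper b₁ t₁ refl
          ; (bottom 2F) _ → b₂≢t₁ }) r)
      ... | yes b₀≡t₂ | yes b₂≡t₁ | no b₁≢t₀ =
        align-≢ (q-proper t₁ t₂ refl) (move b₀ (q t₁) (λ
          { apex _ → q-proper apex t₁ refl
          ; (top 0F) _ → q-proper t₀ t₁ refl
          ; (bottom 1F) _ → q-proper b₁ t₁ refl
          ; (bottom 2F) _ → q-proper t₀ t₁ refl })
        (move b₂ (q t₀) (λ
          { apex _ → q-proper apex t₀ refl
          ; (top 2F) _ → q-proper t₂ t₀ refl
          ; (bottom 0F) _ → q-proper b₀ t₀ refl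
          ; (bottom 1F) _ → b₁≢t₀
          ; (bottom 2F) () }) r))
      -- The bottom repeats the top colours with the wrong shift. No vertex can move within these
      -- four colours, so a fifth one has to unlock b₀.
      ... | yes b₀≡t₂ | yes b₂≡t₁ | yes b₁≡t₀ with fresh₄ 4<ℓ (q apex) (q t₀) (q t₁) (q t₂)
      ...   | δ , apex≢δ , t₀≢δ , t₁≢δ , t₂≢δ =
        align-≢ (t₂≢δ ∘ sym) (move b₀ δ (λ
          { apex _ → apex≢δ
          ; (top 0F) _ → t₀≢δ
          ; (bottom 1F) _ → ≡-≢ t₀≢δ b₁≡t₀
          ; (bottom 2F) _ → ≡-≢ t₁≢δ b₂≡t₁ }) r)

    record Prepared (c : Colouring G ℓ) : Set where
      constructor prepared
      field
        {cycleColour} : Fin 5 → Fin ℓ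
        {hubColour}   : Fin ℓ
        ready         : Fits c (Ready cycleColour hubColour)

    prepend : ∀ {c d} → Path c d → Canonical d → Canonical c
    prepend c⟶d canon = record
      { palette   = palette
      ; injective = injective
      ; canonical = reaches (Path-trans c⟶d (walk canonical)) (holds canonical) }
      where open Canonical canon

    -- The apex and the top triangle are pairwise joined, so their four colours are distinct and
    -- form the palette.
    aligned⇒canonical : ∀ {c} → Aligned c → Canonical c
    aligned⇒canonical al = record
      { palette   = q ∘ rep
      ; injective = λ {i} {j} eq → decidable-stable (i ≟ j) λ i≢j →
          PartTemplate._↝_.is-proper aligned (rep i) (rep j) (rep-joined i j i≢j) eq
      ; canonical = weaken (λ u eq → trans eq (agree (part (role u)))) (PartTemplate._↝_.reached aligned)
      }
      where
      open Aligned al renaming (colours′ to q)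

      rep : Fin 4 → Part
      rep 0F = apex
      rep (suc i) = top i

      rep-joined : ∀ i j → i ≢ j → joined (rep i) (rep j) ≡ true
      rep-joined = from-yes (all? λ i → all? λ j → ¬? (i ≟ j) →-dec (joined (rep i) (rep j) Bool.≟ true))

      agree : ∀ s → q s ≡ q (rep (κᴾ s))
      agree apex = refl
      agree (top 0F) = refl
      agree (top 1F) = refl
      agree (top 2F) = refl
      agree (bottom 0F) = b₀≡t₁
      agree (bottom 1F) = b₁≡t₂
      agree (bottom 2F) = b₂≡t₀

    module _ {d : Colouring G ℓ} {a : Fin 5 → Fin ℓ} {α : Fin ℓ}
      (h : ∀ u → Ready a α (role u) (colour d u)) where

      private
        cycle≡ : ∀ i → colour d (cycle i) ≡ a i
        cycle≡ i = subst (λ r → Ready a α r (colour d (cycle i))) (role-cycle i) (h (cycle i))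

        hub≡ : colour d hub ≡ α
        hub≡ = subst (λ r → Ready a α r (colour d hub)) role-hub (h hub)

        off : ∀ {u r} i → role u ≡ r → adj r (A i) ≡ true → colour d u ≢ a i
        off i u∈r r~Ai = subst (colour d _ ≢_) (cycle≡ i) (near d i u∈r r~Ai)

        α≢a : ∀ i → α ≢ a i
        α≢a i = subst (_≢ a i) hub≡ (off i role-hub refl)

        a≢a : ∀ i j → cyc i j ≡ true → a i ≢ a j
        a≢a i j ij = subst (_≢ a j) (cycle≡ i) (off j (role-cycle i) ij)

        -- `P₃` and `P₄` carry the knowledge that depends on the case: a colour of Y₄ is absent from
        -- Y₃, or Y₄ is empty.
        Partial : (P₃ P₄ : Fin ℓ → Set) → Role → Fin ℓ → Set
        Partial P₃ P₄ (A i) x = x ≡ a i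
        Partial P₃ P₄ (Y 0F) x = x ≡ α
        Partial P₃ P₄ (Y 1F) x = x ≢ a 1F
        Partial P₃ P₄ (Y 2F) x = x ≡ α
        Partial P₃ P₄ (Y 3F) x = x ≢ a 1F × P₃ x
        Partial P₃ P₄ (Y 4F) x = x ≢ a 1F × P₄ x
        Partial P₃ P₄ W x = x ≡ α
        Partial P₃ P₄ Z _ = ⊤

        partial : ∀ {P₃ P₄} → (∀ {u} → role u ≡ Y 3F → P₃ (colour d u)) →
          (∀ {u} → role u ≡ Y 4F → P₄ (colour d u)) → Fits d (Partial P₃ P₄)
        partial {P₃} {P₄} p₃ p₄ = reaches {end = d} (≗⇒Path λ _ → refl) λ u → go u (role u) refl (h u)
          where
          go : ∀ u r → role u ≡ r → Ready a α r (colour d u) → Partial P₃ P₄ r (colour d u)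
          go u (A i) _ eq = eq
          go u (Y 0F) _ eq = eq
          go u (Y 1F) u∈Y _ = off 1F u∈Y refl
          go u (Y 2F) _ eq = eq
          go u (Y 3F) u∈Y _ = off 1F u∈Y refl , p₃ u∈Y
          go u (Y 4F) u∈Y _ = off 1F u∈Y refl , p₄ u∈Y
          go u W _ eq = eq
          go u Z _ _ = tt

        -- Once Z is painted as A₁, the four colours avoided here are all that occur next to Y₁.
        e₁ : Fin ℓ
        e₁ = proj₁ (fresh₄ 4<ℓ (a 1F) (a 3F) (a 4F) α)

        a₁≢e₁ : a 1F ≢ e₁
        a₁≢e₁ = proj₁ (proj₂ (fresh₄ 4<ℓ (a 1F) (a 3F) (a 4F) α))

        a₃≢e₁ : a 3F ≢ e₁
        a₃≢e₁ = proj₁ (proj₂ (proj₂ (fresh₄ 4<ℓ (a 1F) (a 3F) (a 4F) α)))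

        a₄≢e₁ : a 4F ≢ e₁
        a₄≢e₁ = proj₁ (proj₂ (proj₂ (proj₂ (fresh₄ 4<ℓ (a 1F) (a 3F) (a 4F) α))))

        α≢e₁ : α ≢ e₁
        α≢e₁ = proj₂ (proj₂ (proj₂ (proj₂ (fresh₄ 4<ℓ (a 1F) (a 3F) (a 4F) α))))

        Opened : (P₃ P₄ : Fin ℓ → Set) → Role → Fin ℓ → Set
        Opened P₃ P₄ = repaint (Y 1F ∷ []) e₁ (repaint (Z ∷ []) (a 1F) (Partial P₃ P₄))

        -- Z comes first: its neighbours in W, Y₀, Y₂ have colour `α`, while Y₁, Y₃ and Y₄ are
        -- complete to v₁, so the colour of A₁ is free for it.
        open-up : ∀ P₃ P₄ → Fits d (Partial P₃ P₄) → Fits d (Opened P₃ P₄)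
        open-up P₃ P₄ =
          paintRoles (repaint (Z ∷ []) (a 1F) (Partial P₃ P₄)) (Y 1F ∷ []) e₁
            ((≡-≢ a₁≢e₁ ∷ ≡-≢ a₃≢e₁ ∷ ≡-≢ a₄≢e₁ ∷ ≡-≢ α≢e₁ ∷ ≡-≢ α≢e₁ ∷ ≡-≢ a₁≢e₁ ∷ []) ∷ [])
          ∘ paintRoles (Partial P₃ P₄) (Z ∷ []) (a 1F)
            ((≡-≢ (α≢a 1F) ∷ id ∷ ≡-≢ (α≢a 1F) ∷ proj₁ ∷ proj₁ ∷ ≡-≢ (α≢a 1F) ∷ []) ∷ [])

        X₃ X₄ : List Role
        X₃ = Y 3F ∷ A 2F ∷ []
        X₄ = Y 4F ∷ A 0F ∷ []

        finish : ∀ {e₃ e₄} Φ →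
          (∀ r {x} → Φ r x → x ≡ partition α e₁ (a 3F) (a 4F) (a 1F) e₃ e₄ (part r)) →
          α ≢ e₃ → α ≢ e₄ → a 1F ≢ e₃ → a 1F ≢ e₄ → e₃ ≢ e₄ → a 3F ≢ e₃ → a 4F ≢ e₄ →
          Fits d Φ → Canonical d
        finish {e₃} {e₄} Φ final α≢e₃ α≢e₄ a₁≢e₃ a₁≢e₄ e₃≢e₄ a₃≢e₃ a₄≢e₄ fits =
          aligned⇒canonical (align (PartTemplate._,_ q-proper (weaken (λ u → final (role u)) fits)))
          where
          q = partition α e₁ (a 3F) (a 4F) (a 1F) e₃ e₄

          forward : ∀ s t → joined s t ≡ true → q s ≢ q t ⊎ q t ≢ q s
          forward apex (top 0F) _ = inj₁ α≢e₁
          forward apex (top 1F) _ = inj₁ (α≢a 3F)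
          forward apex (top 2F) _ = inj₁ (α≢a 4F)
          forward apex (bottom 0F) _ = inj₁ (α≢a 1F)
          forward apex (bottom 1F) _ = inj₁ α≢e₃
          forward apex (bottom 2F) _ = inj₁ α≢e₄
          forward (top 0F) apex _ = inj₂ α≢e₁
          forward (top 1F) apex _ = inj₂ (α≢a 3F)
          forward (top 2F) apex _ = inj₂ (α≢a 4F)
          forward (bottom 0F) apex _ = inj₂ (α≢a 1F)
          forward (bottom 1F) apex _ = inj₂ α≢e₃
          forward (bottom 2F) apex _ = inj₂ α≢e₄
          forward (top 0F) (top 1F) _ = inj₂ a₃≢e₁
          forward (top 0F) (top 2F) _ = inj₂ a₄≢e₁
          forward (top 1F) (top 0F) _ = inj₁ a₃≢e₁
          forward (top 1F) (top 2F) _ = inj₁ (a≢a 3F 4F refl)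
          forward (top 2F) (top 0F) _ = inj₁ a₄≢e₁
          forward (top 2F) (top 1F) _ = inj₁ (a≢a 4F 3F refl)
          forward (top 2F) (top 2F) ()
          forward (bottom 0F) (bottom 1F) _ = inj₁ a₁≢e₃
          forward (bottom 0F) (bottom 2F) _ = inj₁ a₁≢e₄
          forward (bottom 1F) (bottom 0F) _ = inj₂ a₁≢e₃
          forward (bottom 1F) (bottom 2F) _ = inj₁ e₃≢e₄
          forward (bottom 2F) (bottom 0F) _ = inj₂ a₁≢e₄
          forward (bottom 2F) (bottom 1F) _ = inj₂ e₃≢e₄
          forward (bottom 2F) (bottom 2F) ()
          forward (top 0F) (bottom 0F) _ = inj₂ a₁≢e₁
          forward (top 1F) (bottom 1F) _ = inj₁ a₃≢e₃
          forward (top 2F) (bottom 2F) _ = inj₁ a₄≢e₄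
          forward (bottom 0F) (top 0F) _ = inj₁ a₁≢e₁
          forward (bottom 1F) (top 1F) _ = inj₂ a₃≢e₃
          forward (bottom 2F) (top 2F) _ = inj₂ a₄≢e₄

          q-proper : PartTemplate.Proper q
          q-proper s t st with forward s t st
          ... | inj₁ s≢t = s≢t
          ... | inj₂ t≢s = t≢s ∘ sym

      -- Y₃ and Y₄ are complete to each other, so a colour e₄ occurring in Y₄ is
      -- free on Y₃ and Y₄ can be made monochromatic before Y₃. If Y₄ is empty
      -- then Y₃, which may still carry several colours, comes first.
      ready⇒canonical : Canonical d
      ready⇒canonical with any? (λ y → role y ≟ᴿ Y 4F)
      ... | yes (y , y∈Y₄) with fresh₄ 4<ℓ (a 1F) (a 3F) α (colour d y)
      ...   | e₃ , a₁≢e₃ , a₃≢e₃ , α≢e₃ , e₄≢e₃ =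
        finish (repaint X₃ e₃ (repaint X₄ e₄ (Opened P₃ P₄)))
          (λ { (A 0F) → id ; (A 1F) → id ; (A 2F) → id ; (A 3F) → id ; (A 4F) → id
             ; (Y 0F) → id ; (Y 1F) → id ; (Y 2F) → id ; (Y 3F) → id ; (Y 4F) → id
             ; W → id ; Z → id })
          α≢e₃ (α≢e₄ ∘ sym) a₁≢e₃ (e₄≢a 1F refl ∘ sym) (e₄≢e₃ ∘ sym) a₃≢e₃ (e₄≢a 4F refl ∘ sym)
          (paintRoles (repaint X₄ e₄ (Opened P₃ P₄)) X₃ e₃
            ((≡-≢ e₄≢e₃ ∷ ≡-≢ a₁≢e₃ ∷ ≡-≢ a₃≢e₃ ∷ ≡-≢ α≢e₃ ∷ ≡-≢ e₄≢e₃ ∷ ≡-≢ a₁≢e₃ ∷ [])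
            ∷ (≡-≢ a₁≢e₃ ∷ ≡-≢ a₃≢e₃ ∷ ≡-≢ α≢e₃ ∷ ≡-≢ α≢e₃ ∷ ≡-≢ e₄≢e₃ ∷ ≡-≢ α≢e₃ ∷ [])
            ∷ [])
          (paintRoles (Opened P₃ P₄) X₄ e₄
            ((≡-≢ (e₄≢a 1F refl ∘ sym) ∷ ≡-≢ (e₄≢a 2F refl ∘ sym) ∷ ≡-≢ (e₄≢a 4F refl ∘ sym)
               ∷ ≡-≢ (α≢e₄ ∘ sym) ∷ proj₂ ∷ ≡-≢ (e₄≢a 1F refl ∘ sym) ∷ [])
            ∷ (≡-≢ (e₄≢a 1F refl ∘ sym) ∷ ≡-≢ (e₄≢a 4F refl ∘ sym)
               ∷ ≡-≢ (α≢e₄ ∘ sym) ∷ ≡-≢ (α≢e₄ ∘ sym) ∷ proj₂ ∷ ≡-≢ (α≢e₄ ∘ sym) ∷ [])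
            ∷ [])
          (open-up P₃ P₄ (partial (λ u∈Y₃ → proper d _ y (Y-complete u∈Y₃ y∈Y₄ refl)) (λ _ → tt)))))
        where
        e₄ = colour d y
        P₃ P₄ : Fin ℓ → Set
        P₃ = _≢ e₄
        P₄ _ = ⊤
        e₄≢a : ∀ i → adj (Y 4F) (A i) ≡ true → e₄ ≢ a i
        e₄≢a i = off i y∈Y₄
        α≢e₄ : e₄ ≢ α
        α≢e₄ = subst (λ r → Ready a α r e₄) y∈Y₄ (h y)
      ready⇒canonical | no Y₄-empty
        -- A₀ is not yet repainted when Y₃ and A₂ receive `e₃`, hence `a 0F` among the colours to
        -- avoid.
        with fresh₄ 4<ℓ (a 0F) (a 1F) (a 3F) α
      ...   | e₃ , a₀≢e₃ , a₁≢e₃ , a₃≢e₃ , α≢e₃ with fresh₄ 4<ℓ (a 1F) (a 4F) e₃ α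
      ...   | e₄ , a₁≢e₄ , a₄≢e₄ , e₃≢e₄ , α≢e₄ =
        finish (repaint X₄ e₄ (repaint X₃ e₃ (Opened P₃ P₄)))
          (λ { (A 0F) → id ; (A 1F) → id ; (A 2F) → id ; (A 3F) → id ; (A 4F) → id
             ; (Y 0F) → id ; (Y 1F) → id ; (Y 2F) → id ; (Y 3F) → id ; (Y 4F) → id
             ; W → id ; Z → id })
          α≢e₃ α≢e₄ a₁≢e₃ a₁≢e₄ e₃≢e₄ a₃≢e₃ a₄≢e₄
          (paintRoles (repaint X₃ e₃ (Opened P₃ P₄)) X₄ e₄
            ((≡-≢ a₁≢e₄ ∷ ≡-≢ e₃≢e₄ ∷ ≡-≢ a₄≢e₄ ∷ ≡-≢ α≢e₄ ∷ ≡-≢ e₃≢e₄ ∷ ≡-≢ a₁≢e₄ ∷ [])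
            ∷ (≡-≢ a₁≢e₄ ∷ ≡-≢ a₄≢e₄ ∷ ≡-≢ α≢e₄ ∷ ≡-≢ α≢e₄ ∷ ≡-≢ e₃≢e₄ ∷ ≡-≢ α≢e₄ ∷ [])
            ∷ [])
          (paintRoles (Opened P₃ P₄) X₃ e₃
            ((≡-≢ a₀≢e₃ ∷ ≡-≢ a₁≢e₃ ∷ ≡-≢ a₃≢e₃ ∷ ≡-≢ α≢e₃ ∷ (λ ()) ∷ ≡-≢ a₁≢e₃ ∷ [])
            ∷ (≡-≢ a₁≢e₃ ∷ ≡-≢ a₃≢e₃ ∷ ≡-≢ α≢e₃ ∷ ≡-≢ α≢e₃ ∷ (λ ()) ∷ ≡-≢ α≢e₃ ∷ [])
            ∷ [])
          (open-up P₃ P₄ (partial (λ _ → tt) (λ u∈Y₄ → Y₄-empty (_ , u∈Y₄))))))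
        where
        P₃ P₄ : Fin ℓ → Set
        P₃ _ = ⊤
        P₄ _ = ⊥

    prepared⇒canonical : ∀ {c} → Prepared c → Canonical c
    prepared⇒canonical (prepared (reaches walk h)) = prepend walk (ready⇒canonical h)

  -- Reaching a prepared colouring

  module _ (S : Structure G) where
    open Structure S
    open WithStructure S

    -- With a fifth colour, Y₂ can leave the class W ∪ Y₀ ∪ Y₂ and Y₃ join it.
    canonical⇒prepared : ∀ {c} → Canonical c → WithStructure.Prepared (rotateStructure 2F S) c
    canonical⇒prepared {c} canon = WithStructure.prepared (weaken (λ u → turned (role u)) (reached turn))
      where
      open Canonical canon renaming (palette to p)
      open RoleTemplate

      δ = proj₁ (fresh 4<ℓ p)
      p≢δ = proj₂ (fresh 4<ℓ p)

      p-≢ : ∀ {i j} → i ≢ j → p i ≢ p j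
      p-≢ i≢j = i≢j ∘ injective

      q : Role → Fin ℓ
      q = (p ∘ κ) [ Y 2F ≔ δ ] [ Y 3F ≔ p 0F ]

      turn : c ↝ q
      -- Y₂ is the only neighbour of Y₃ in the class of W, and it has just moved to `δ`. Rotation by
      -- two then sends Y₀ to Y₂ and Y₃ to Y₀.
      turn = move (Y 3F) (p 0F)
        (λ { (A 0F) _ → p-≢ λ () ; (A 1F) _ → p-≢ λ () ; (A 3F) _ → p-≢ λ () ; (A 4F) ()
           ; (Y 2F) _ → p≢δ 0F ∘ sym ; (Y 4F) _ → p-≢ λ () ; Z _ → p-≢ λ () })
        (move (Y 2F) δ (λ r _ → p≢δ (κ r)) ((λ r s → p-≢ ∘ κ-proper r s) , canonical))

      turned : ∀ r {x} → x ≡ q r → Ready (λ i → q (A (⊖ 2F ⊕ i))) (p 0F) (rotate 2F r) x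
      turned (A i) refl = cong q (sym (rotate-⊖ 2F (A i)))
      turned (Y 0F) refl = refl
      turned (Y 1F) refl = p-≢ λ ()
      turned (Y 2F) refl = p≢δ 0F ∘ sym
      turned (Y 3F) refl = refl
      turned (Y 4F) refl = p-≢ λ ()
      turned W refl = refl
      turned Z refl = tt

    private
      representative : Role → Fin n → Fin n
      representative (A i) _ = cycle i
      representative _ u = u

      representative-adj : ∀ {u v r} → role v ≡ r → Adj G u v → Adj G u (representative r v)
      representative-adj {u} {r = A i} v∈A uv =
        A-complete i (trans (cong (adj (role u)) (sym v∈A)) (role-adj uv))
      representative-adj {r = Y _} _ uv = uv
      representative-adj {r = W} _ uv = uv
      representative-adj {r = Z} _ uv = uv

    Uniform : Colouring G ℓ → Set
    Uniform c = ∀ {u} i → role u ≡ A i → colour c u ≡ colour c (cycle i)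

    -- Every neighbour of a vertex of Aᵢ is a neighbour of vᵢ, so all the classes can copy their
    -- representatives in one switch.
    uniformise : ∀ c → ∃[ d ] (Path c d × Uniform d)
    uniformise c = end reached , walk reached , λ i u∈A →
      trans (trans (holds reached _) (cong (λ r → colour c (representative r _)) u∈A))
            (sym (trans (holds reached _) (cong (λ r → colour c (representative r _)) (role-cycle i))))
      where
      target : Fin n → Fin n
      target u = representative (role u) u

      target-adj : ∀ {u v} → Adj G u v → Adj G u (target v)
      target-adj = representative-adj refl

      reached : Reaches c (λ u x → x ≡ colour c (target u))
      reached = switchTo (colour c ∘ target)
        (λ uv → proper c _ _ (Adj-sym G (target-adj (Adj-sym G (target-adj uv)))))
        (λ uv → proper c _ _ (target-adj uv))

    module _ {d : Colouring G ℓ} (uniform : Uniform d) where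

      private
        a = λ i → colour d (cycle i)
        α = colour d hub

        α≢a : ∀ i → α ≢ a i
        α≢a i = near d i role-hub refl

        Cleared : Role → Fin ℓ → Set
        Cleared (A i) x = x ≡ a i
        Cleared (Y _) _ = ⊤
        Cleared W _ = ⊤
        Cleared Z x = x ≢ α

        -- By `Z-hub` a Z vertex with a neighbour in Y is adjacent to the hub, hence not coloured
        -- `α`. Those coloured `α` thus have neighbours in W only, and W avoids `a 0F`.
        clear-Z : Fits d Cleared
        clear-Z = weaken (λ u → cleared u (role u) refl)
          (paint (λ u → role u ≟ᴿ Z ×-dec colour d u ≟ α) (a 0F) λ {u} {v} uv (v∈Z , v-α) →
            free uv v∈Z v-α (role u) refl
            , λ (u∈Z , _) → contradiction (trans (sym (role-adj uv)) (cong₂ adj u∈Z v∈Z)) λ ())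
          where
          free : ∀ {u v} → Adj G u v → role v ≡ Z → colour d v ≡ α → ∀ r → role u ≡ r → colour d u ≢ a 0F
          free uv v∈Z v-α (Y i) u∈Y = contradiction v-α (proper d _ _ (Z-hub v∈Z u∈Y (Adj-sym G uv)))
          free uv v∈Z v-α W u∈W = near d 0F u∈W refl
          free uv v∈Z _ (A i) u∈A = contradiction (trans (sym (role-adj uv)) (cong₂ adj u∈A v∈Z)) λ ()
          free uv v∈Z _ Z u∈Z = contradiction (trans (sym (role-adj uv)) (cong₂ adj u∈Z v∈Z)) λ ()

          cleared : ∀ u r → role u ≡ r → ∀ {x} →
            (role u ≡ Z × colour d u ≡ α → x ≡ a 0F) × (¬ (role u ≡ Z × colour d u ≡ α) → x ≡ colour d u) →
            Cleared r x
          cleared u (A i) u∈A (_ , out) = trans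
            (out λ (u∈Z , _) → contradiction (trans (sym u∈A) u∈Z) λ ()) (uniform i u∈A)
          cleared u (Y _) _ _ = tt
          cleared u W _ _ = tt
          cleared u Z u∈Z (inn , out) with colour d u ≟ α
          ... | yes u-α = ≡-≢ (α≢a 0F ∘ sym) (inn (u∈Z , u-α))
          ... | no ¬u-α = ≡-≢ ¬u-α (out (¬u-α ∘ proj₂))

      uniform⇒settled : Fits d (Settled a α)
      uniform⇒settled = weaken (λ u → settled (role u)) (paintRoles Cleared (W ∷ []) α
          ((≡-≢ (α≢a 0F ∘ sym) ∷ ≡-≢ (α≢a 1F ∘ sym) ∷ ≡-≢ (α≢a 2F ∘ sym) ∷
            ≡-≢ (α≢a 3F ∘ sym) ∷ ≡-≢ (α≢a 4F ∘ sym) ∷ id ∷ []) ∷ []) clear-Z)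
        where
        settled : ∀ r {x} → repaint (W ∷ []) α Cleared r x → Settled a α r x
        settled (A _) = id
        settled (Y _) = id
        settled W = id
        settled Z = id

    module _ {e : Colouring G ℓ} {a : Fin 5 → Fin ℓ} {α : Fin ℓ}
      (h : ∀ u → Settled a α (role u) (colour e u)) where

      private
        a≢α : ∀ i → a i ≢ α
        a≢α i eq = near e i role-hub refl (trans
          (subst (λ r → Settled a α r (colour e hub)) role-hub (h hub))
          (sym (trans (subst (λ r → Settled a α r (colour e (cycle i))) (role-cycle i) (h (cycle i))) eq)))

        used? : ∀ j → Dec (∃[ u ] (role u ≡ Y j × colour e u ≡ α))
        used? j = any? λ u → role u ≟ᴿ Y j ×-dec colour e u ≟ α

        used-independent : ∀ i j → cyc i j ≡ true → does (used? i) ≡ true → does (used? j) ≡ false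
        used-independent i j ij used-i with used? i
        ... | yes (u , u∈Y , u-α) = dec-false (used? j) λ (v , v∈Y , v-α) →
          proper e u v (Y-complete u∈Y v∈Y ij) (trans u-α (sym v-α))

      -- After the rotation `α` occurs within Y only in Y₀ and Y₂. All neighbours of these lie in A,
      -- Y₁, Y₃, Y₄ or Z and avoid `α`.
      rotated⇒prepared : ∀ k → (∀ i → does (used? i) ≡ true → k ⊕ i ≡ 0F ⊎ k ⊕ i ≡ 2F) →
        WithStructure.Prepared (rotateStructure k S) e
      rotated⇒prepared k used-rotated = WithStructure.prepared (weaken (λ u → ready (rotate k (role u)))
          (WithStructure.paintRoles Sᵏ Pending (Y 0F ∷ Y 2F ∷ []) α
            ((≡-≢ (≢a 0F) ∷ ≡-≢ (≢a 2F) ∷ ≡-≢ (≢a 3F) ∷ id ∷ id ∷ id ∷ [])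
            ∷ (≡-≢ (≢a 0F) ∷ ≡-≢ (≢a 2F) ∷ ≡-≢ (≢a 4F) ∷ id ∷ id ∷ id ∷ [])
            ∷ []) (reaches {end = e} (≗⇒Path λ _ → refl) λ u → pending u (role u) refl (h u))))
        where
        Sᵏ = rotateStructure k S

        aᵏ : Fin 5 → Fin ℓ
        aᵏ i = a (⊖ k ⊕ i)

        ≢a : ∀ i → aᵏ i ≢ α
        ≢a i = a≢α _

        a⊖⊕ : ∀ i → a i ≡ aᵏ (k ⊕ i)
        a⊖⊕ i = cong a (sym (⊖-⊕ k i))

        Pending : Role → Fin ℓ → Set
        Pending (A i) x = x ≡ aᵏ i
        Pending (Y 0F) _ = ⊤
        Pending (Y 1F) x = x ≢ α
        Pending (Y 2F) _ = ⊤
        Pending (Y 3F) x = x ≢ α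
        Pending (Y 4F) x = x ≢ α
        Pending W x = x ≡ α
        Pending Z x = x ≢ α

        pending : ∀ u r → role u ≡ r → Settled a α r (colour e u) → Pending (rotate k r) (colour e u)
        pending u (A i) _ eq = trans eq (a⊖⊕ i)
        pending u W _ eq = eq
        pending u Z _ x≢α = x≢α
        pending u (Y i) u∈Y _ with colour e u ≟ α
        ... | yes u-α with k ⊕ i | used-rotated i (dec-true (used? i) (u , u∈Y , u-α))
        ...   | _ | inj₁ refl = tt
        ...   | _ | inj₂ refl = tt
        pending u (Y i) u∈Y _ | no ¬u-α with k ⊕ i
        ... | 0F = tt
        ... | 1F = ¬u-α
        ... | 2F = tt
        ... | 3F = ¬u-α
        ... | 4F = ¬u-α

        ready : ∀ r {x} → repaint (Y 0F ∷ Y 2F ∷ []) α Pending r x → Ready aᵏ α r x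
        ready (A i) = id
        ready (Y 0F) = id
        ready (Y 1F) = id
        ready (Y 2F) = id
        ready (Y 3F) = id
        ready (Y 4F) = id
        ready W = id
        ready Z _ = tt

      settled⇒prepared : ∃[ k ] WithStructure.Prepared (rotateStructure k S) e
      settled⇒prepared = map₂ (λ {k} → rotated⇒prepared k) (independent⇒rotation (does ∘ used?) used-independent)

  -- Undoing the rotation

  open WithStructure

  turn : ∀ S {c} → Canonical S c → Canonical (rotateStructure 2F S) c
  turn S = prepared⇒canonical _ ∘ canonical⇒prepared S

  -- `Canonical` depends on a structure only through its roles, so comparing these pointwise
  -- replaces an equality of structures.
  unturn : ∀ S T {c} → (∀ u → Structure.role T u ≡ Structure.role S u) → Canonical T c → Canonical S c
  unturn S T same canon = record
    { palette   = palette
    ; injective = injective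
    ; canonical = weaken (λ u eq → trans eq (cong (palette ∘ κ) (same u))) canonical }
    where open Canonical canon

  -- The number t of turns satisfies k + 2t ≡ 0 (mod 5).
  unrotate : ∀ S k {c} → Canonical (rotateStructure k S) c → Canonical S c
  unrotate S 0F = unturn S _ (λ u → rotate-0 (Structure.role S u))
  unrotate S 1F = unturn S _ (λ u → rotate-221 (Structure.role S u)) ∘ turn _ ∘ turn _
  unrotate S 2F = unturn S _ (λ u → rotate-22222 (Structure.role S u)) ∘ turn _ ∘ turn _ ∘ turn _ ∘ turn _
  unrotate S 3F = unturn S _ (λ u → rotate-⊖ 3F (Structure.role S u)) ∘ turn _
  unrotate S 4F = unturn S _ (λ u → rotate-2224 (Structure.role S u)) ∘ turn _ ∘ turn _ ∘ turn _

  canonicalise : ∀ S c → Canonical S c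
  canonicalise S c = from-uniform (uniformise S c)
    where
    from-prepared : ∀ {d} → ∃[ k ] Prepared (rotateStructure k S) d → Canonical S d
    from-prepared (k , prep) = unrotate S k (prepared⇒canonical _ prep)

    from-settled : ∀ {d a α} → Fits S d (Settled a α) → Canonical S d
    from-settled (reaches walk h) = prepend S walk (from-prepared (settled⇒prepared S h))

    from-uniform : ∃[ d ] (Path c d × Uniform S d) → Canonical S c
    from-uniform (d , c⟶d , uniform) = prepend S c⟶d (from-settled (uniform⇒settled S uniform))

  -- Renaming the colours of the four classes

  module _ (S : Structure G) where
    open Structure S

    private
      module K₄Template = Template {T = Fin 4} _≢_ (λ s≢t → s≢t ∘ sym) _≟_ (κ ∘ role)
        (λ {u} {v} uv → κ-proper (role u) (role v) (role-adj uv))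
      open K₄Template

      -- A class holding `β` first retreats to a spare colour, then class `k` takes `β`. The other
      -- classes stay put, so colours fixed earlier survive later calls.
      fix : ∀ {c p} {R : Set} k (β : Fin ℓ) → c ↝ p →
        (∀ {p′} → c ↝ p′ → p′ k ≡ β → (∀ i → i ≢ k → p i ≢ β → p′ i ≡ p i) → R) → R
      fix {c} {p} k β r@(p-proper , _) continue =
        continue (move k β evicted-free (switch evicted-proper evicted-compatible r)) updated kept
        where
        δ = proj₁ (fresh 4<ℓ p)
        p≢δ = proj₂ (fresh 4<ℓ p)

        evicted : Fin 4 → Fin ℓ
        evicted i = if does (p i ≟ β) then δ else p i

        evicted-free : ∀ i → i ≢ k → evicted i ≢ β
        evicted-free i _ with p i ≟ β
        ... | yes pi≡β = λ δ≡β → p≢δ i (trans pi≡β (sym δ≡β))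
        ... | no pi≢β = pi≢β

        evicted-compatible : ∀ i j → i ≢ j → p i ≢ evicted j
        evicted-compatible i j i≢j with p j ≟ β
        ... | yes _ = p≢δ i
        ... | no _ = p-proper i j i≢j

        evicted-proper : Proper evicted
        evicted-proper i j i≢j with p i ≟ β
        ... | no _ = evicted-compatible i j i≢j
        ... | yes pi≡β with p j ≟ β
        ...   | yes pj≡β = contradiction (trans pi≡β (sym pj≡β)) (p-proper i j i≢j)
        ...   | no _ = p≢δ j ∘ sym

        updated : (evicted [ k ≔ β ]) k ≡ β
        updated with k ≟ k
        ... | yes _ = refl
        ... | no k≢k = contradiction refl k≢k

        kept : ∀ i → i ≢ k → p i ≢ β → (evicted [ k ≔ β ]) i ≡ p i
        kept i i≢k pi≢β with k ≟ i
        ... | yes k≡i = contradiction (sym k≡i) i≢k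
        ... | no _ with p i ≟ β
        ...   | yes pi≡β = contradiction pi≡β pi≢β
        ...   | no _ = refl

    rename : ∀ {c} (q : Fin 4 → Fin ℓ) → (∀ {i j} → q i ≡ q j → i ≡ j) →
      Canonical S c → Reaches c (λ u x → x ≡ q (κ (role u)))
    rename {c} q q-injective canon =
      fix 0F (q 0F) ((λ i j i≢j → i≢j ∘ injective) , canonical) λ r₁ p₁0 _ →
      fix 1F (q 1F) r₁ λ r₂ p₂1 keep₂ →
      fix 2F (q 2F) r₂ λ r₃ p₃2 keep₃ →
      fix 3F (q 3F) r₃ λ {p₄} r₄ p₄3 keep₄ →
      let p₂0 = trans (keep₂ 0F (λ ()) (q-≢ (λ ()) p₁0)) p₁0
          p₃0 = trans (keep₃ 0F (λ ()) (q-≢ (λ ()) p₂0)) p₂0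
          p₃1 = trans (keep₃ 1F (λ ()) (q-≢ (λ ()) p₂1)) p₂1
          agree : ∀ i → p₄ i ≡ q i
          agree = λ { 0F → trans (keep₄ 0F (λ ()) (q-≢ (λ ()) p₃0)) p₃0
                    ; 1F → trans (keep₄ 1F (λ ()) (q-≢ (λ ()) p₃1)) p₃1
                    ; 2F → trans (keep₄ 2F (λ ()) (q-≢ (λ ()) p₃2)) p₃2
                    ; 3F → p₄3 }
      in weaken (λ u eq → trans eq (agree (κ (role u)))) (reached r₄)
      where
      open Canonical canon
      q-≢ : ∀ {i j x} → i ≢ j → x ≡ q i → x ≢ q j
      q-≢ i≢j = ≡-≢ (i≢j ∘ q-injective)

    canonicals-connected : ∀ {c d} → Canonical S c → Canonical S d → Path c d
    canonicals-connected {c} c-canonical d-canonical = Path-trans (walk renamed)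
      (Path-trans (≗⇒Path λ u → trans (holds renamed u) (sym (holds canonical u))) (Path-sym (walk canonical)))
      where
      open Canonical d-canonical
      renamed : Reaches c (λ u x → x ≡ palette (κ (role u)))
      renamed = rename palette injective c-canonical

    all-connected : ∀ c d → Path c d
    all-connected c d = canonicals-connected (canonicalise S c) (canonicalise S d)

-- Detours, the chromatic number and the conclusion

differentColouring : ∀ {n} {G : Graph (Fin n)} {ℓ} {u v} → Adj G u v → (c : Colouring G ℓ) →
  ∃[ d ] colours c ≢ colours {G = G} d
differentColouring {G = G} {u = u} {v} uv c = colouringOf f f-proper , λ eq → proper c u v uv
    (trans (cong (λ cs → lookup cs u) eq) (trans (colour-colouringOf {G = G} f f-proper u) fu))
  where
  π = transpose (colour c u) (colour c v)
  f = λ w → π ⟨$⟩ʳ colour c w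

  f-proper : ∀ {x y} → Adj G x y → f x ≢ f y
  f-proper xy eq = proper c _ _ xy
    (trans (sym (inverseˡ π)) (trans (cong (π ⟨$⟩ˡ_) eq) (inverseˡ π)))

  fu : f u ≡ colour c v
  fu with colour c u ≟ colour c u
  ... | yes _ = refl
  ... | no u≢u = contradiction refl u≢u

-- The odd cycle needs three colours and the hub a fourth. If v₀ and v₂ agree, then v₃ differs from
-- v₀ because it differs from v₂.
structure⇒4≤ : ∀ {n} {G : Graph (Fin n)} {k} → Structure G → Colouring G k → 4 ≤ k
structure⇒4≤ {G = G} {k} S c = cases (γ 0F ≟ γ 2F)
  where
  open Structure S
  γ : Fin 5 → Fin k
  γ i = colour c (cycle i)

  γ-≢ : ∀ i j → cyc i j ≡ true → γ i ≢ γ j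
  γ-≢ i j ij = proper c _ _ (A-complete j (trans (cong (λ r → adj r (A j)) (role-cycle i)) ij))

  hub-≢ : ∀ i → colour c hub ≢ γ i
  hub-≢ i = proper c _ _ (A-complete i (cong (λ r → adj r (A i)) role-hub))

  distinct : ∀ x y z → γ x ≢ γ y → γ x ≢ γ z → γ y ≢ γ z → 4 ≤ k
  distinct x y z xy xz yz = injective⇒≤ {f = f} λ {i} {j} → inj i j
    where
    f : Fin 4 → Fin k
    f 0F = colour c hub
    f 1F = γ x
    f 2F = γ y
    f 3F = γ z
    inj : ∀ i j → f i ≡ f j → i ≡ j
    inj 0F 0F _ = refl
    inj 0F 1F eq = contradiction eq (hub-≢ x)
    inj 0F 2F eq = contradiction eq (hub-≢ y)
    inj 0F 3F eq = contradiction eq (hub-≢ z)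
    inj 1F 0F eq = contradiction (sym eq) (hub-≢ x)
    inj 1F 1F _ = refl
    inj 1F 2F eq = contradiction eq xy
    inj 1F 3F eq = contradiction eq xz
    inj 2F 0F eq = contradiction (sym eq) (hub-≢ y)
    inj 2F 1F eq = contradiction (sym eq) xy
    inj 2F 2F _ = refl
    inj 2F 3F eq = contradiction eq yz
    inj 3F 0F eq = contradiction (sym eq) (hub-≢ z)
    inj 3F 1F eq = contradiction (sym eq) xz
    inj 3F 2F eq = contradiction (sym eq) yz
    inj 3F 3F _ = refl

  cases : Dec (γ 0F ≡ γ 2F) → 4 ≤ k
  cases (no γ₀≢γ₂) = distinct 0F 1F 2F (γ-≢ 0F 1F refl) γ₀≢γ₂ (γ-≢ 1F 2F refl)
  cases (yes γ₀≡γ₂) = distinct 0F 3F 4F (≡-≢ (γ-≢ 2F 3F refl) γ₀≡γ₂) (γ-≢ 0F 4F refl) (γ-≢ 3F 4F refl)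

theorem1p7 : ∀ (n : ℕ) (G : Graph (Fin n)) →
    G FreeOf 2K₂ → G FreeOf K 4 → G FreeOf H₄ →
    G ContainsInduced W₅ →
    Recolourable G
theorem1p7 n G no-2K₂ no-K₄ no-H₄ W₅⊆G k χ ℓ k<ℓ =
  Path⇒Connected (Recolouring.all-connected 4<ℓ S)
    (differentColouring (Structure.A-complete S 0F (cong (λ r → adj r (A 0F)) (Structure.role-hub S))))
  where
  S = containsW₅⇒structure no-2K₂ no-K₄ no-H₄ W₅⊆G
  4<ℓ = ≤-<-trans (structure⇒4≤ S (IsChromaticNumber.colouring χ)) k<ℓ
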